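{- For every odd prime $p$ and all integers $c, n \ge 1$, the chromatic number of the hypergraph $\mathtt{KH}^{n}_{p^2 c}(\mathbb{Z}_p)$ is at least $c+1$; i.e., every map $\chi:\mathbb{Z}_p^n\to[c]$ has a monochromatic hyperedge.
   Context: For an alphabet $\Sigma$ of size $p$ and integers $0\le t$, $n\ge1$, $\mathtt{KH}^{n}_{t}(\Sigma)$ is the $p$-uniform hypergraph with vertex set $\Sigma^n$ in which $p$ distinct vertices $\mathbf{x}^1,\dots,\mathbf{x}^p\in\Sigma^n$ form a hyperedge iff $|\{\mathbf{x}^1_i,\dots,\mathbf{x}^p_i\}| = p$ holds for at least $n-t$ coordinates $i\in[n]$. The chromatic number is the least number of colors in a vertex coloring with no monochromatic hyperedge.
   Formalization: The condition c(p−1) < p^n is added: without it the p^n vertices split into c color classes of at most p−1 vertices each, so no monochromatic hyperedge of p distinct vertices exists (e.g. p=3, c=2, n=1). -}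

module Defs where

open import Data.Nat using (ℕ; _∸_; _≤_; _≟_)
open import Data.Fin using (Fin)
open import Data.Fin.Subset using (⋃; ⁅_⁆; ∣_∣)
open import Data.List using (length; filter; map; allFin)
open import Data.Vec using (Vec; lookup)
open import Data.Product using (Σ; ∃-syntax; _×_; proj₁)
open import Function.Definitions using (Injective)
open import Relation.Nullary using (¬_)
open import Relation.Binary.PropositionalEquality using (_≡_)

-- A hyperedge {x¹,…,xᵏ} is given by an injective enumeration Fin k → Vertex,
-- so each k-element hyperedge is represented by its k! orderings.
record UniformHypergraph (k : ℕ) : Set₁ where
  field
    Vertex   : Set
    IsEdge   : (Fin k → Vertex) → Set
    distinct : ∀ {x} → IsEdge x → Injective _≡_ _≡_ x

module _ {k : ℕ} (H : UniformHypergraph k) where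
  open UniformHypergraph H

  Monochromatic : {m : ℕ} → (Vertex → Fin m) → (Fin k → Vertex) → Set
  Monochromatic χ x = ∀ i j → χ (x i) ≡ χ (x j)

  HasMonochromaticEdge : {m : ℕ} → (Vertex → Fin m) → Set
  HasMonochromaticEdge χ = ∃[ x ] IsEdge x × Monochromatic χ x

  Colourable : ℕ → Set
  Colourable m = Σ (Vertex → Fin m) λ χ → ¬ HasMonochromaticEdge χ

  IsChromaticNumber : ℕ → Set
  IsChromaticNumber m = Colourable m × (∀ l → Colourable l → m ≤ l)

-- Only the underlying set {0,…,p-1} of ℤ/pℤ matters: it serves as an alphabet.
ℤ/ : ℕ → Set
ℤ/ p = Fin p

-- |{x¹ᵢ,…,xᵖᵢ}|
symbolCount : {p n : ℕ} → (Fin p → Vec (ℤ/ p) n) → Fin n → ℕ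
symbolCount {p} x i = ∣ ⋃ (map (λ j → ⁅ lookup (x j) i ⁆) (allFin p)) ∣

rainbowCoordinates : {p n : ℕ} → (Fin p → Vec (ℤ/ p) n) → ℕ
rainbowCoordinates {p} {n} x = length (filter (λ i → symbolCount x i ≟ p) (allFin n))

-- Truncated subtraction is harmless here: for t ≥ n the condition
-- "at least n - t coordinates" is vacuous either way.
KH : (p n t : ℕ) → UniformHypergraph p
KH p n t = record
  { Vertex   = Vec (ℤ/ p) n
  ; IsEdge   = λ x → Injective _≡_ _≡_ x × n ∸ t ≤ rainbowCoordinates x
  ; distinct = proj₁
  }

{-# OPTIONS --safe #-}
-- For n ≤ p²c every p words form an edge, and the pigeonhole principle suffices.
--
-- Otherwise put T = 2 (c (p - 1) + 1) ≤ p²c and consider the partial words with at most T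
-- stars, ordered by inclusion of the sets of their completions; ℤ/p acts by adding constants.
-- To a partial word x attach the pairs (i, g) such that some completion w of x has
-- χ (w + g) = i.  If for some i all p values of g occur, the corresponding p words w + g are
-- a monochromatic edge, since they are rainbow on every coordinate that is not a star of x.
-- If this never happens, the number of pairs, which increases with x, is at most c (p - 1).
--
-- Filling in one coordinate after the other contracts the poset at the price of one extra
-- star, so a k-cocycle on chains with at most k + 1 stars is exact on chains with at most k
-- stars.  An integral function f of the attached pairs whose sum over each orbit is 1 yields
-- cocycles W k of degree 2 k, the powers of the generator of the second cohomology of ℤ/p.
-- A factor of W k vanishes on a part of the chain where the pairs do not grow, so W k
-- vanishes for k > c (p - 1).  Descending in k, W k = d (N G) for all smaller k, with N the
-- norm of ℤ/p and G depending on k; in degree 0 this reads 1 = p G, a contradiction.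
module Submission where

open import Defs
open import Data.Nat using (ℕ; suc; _*_; _^_; _∸_; _≤_; _<_)
open import Data.Nat.Divisibility using (_∣_)
open import Data.Nat.Primality using (Prime)
open import Data.Fin using (Fin)
open import Data.Vec using (Vec)
open import Data.Product using (_×_)
open import Relation.Nullary using (¬_)

open import Data.Bool using (Bool; true; false)
open import Data.Empty using (⊥; ⊥-elim)
open import Data.Fin using (toℕ; fromℕ<; inject≤; zero; suc) renaming (_≟_ to _≟ᶠ_)
open import Data.Fin.Properties using (toℕ-fromℕ<; toℕ-injective; toℕ<n; any?; all?; inject≤-injective)
open import Data.Fin.Subset using (Subset; ⋃; ⁅_⁆; _∈_; ∣_∣)
open import Data.Fin.Subset.Properties using (x∈⁅x⁆; ⊆-antisym; ⊆-max; ∣⊤∣≡n; x∈p∪q⁺)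
open import Data.Integer.Base using (ℤ; +_; 0ℤ; 1ℤ) renaming (_+_ to _+ᶻ_; _*_ to _*ᶻ_; _-_ to _-ᶻ_; -_ to neg; ∣_∣ to abs)
import Data.Integer.Properties as ℤₚ
open import Data.Integer.Tactic.RingSolver using (solve-∀)
import Data.List as List
open import Data.List using (List; []; _∷_; map; length; filter; tabulate; allFin; cartesianProductWith)
open import Data.List.Membership.Propositional using () renaming (_∈_ to _∈ˡ_)
open import Data.List.Membership.Propositional.Properties using (∈-allFin; ∈-map⁺; ∈-lookup)
open import Data.List.Properties using (map-∘; map-cong; map-id; length-map; length-++; length-tabulate)
open import Data.List.Relation.Unary.All as All using (All; []; _∷_)
import Data.List.Relation.Unary.All.Properties as All
open import Data.List.Relation.Unary.AllPairs using ([]; _∷_)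
open import Data.List.Relation.Unary.Any using (here; there)
open import Data.List.Relation.Unary.Linked as Linked using (Linked; []; [-]; _∷_)
import Data.List.Relation.Unary.Linked.Properties as Linked
open import Data.List.Relation.Unary.Unique.Propositional using (Unique)
import Data.List.Relation.Unary.Unique.Propositional.Properties as Unique
open import Data.Maybe as Maybe using (Maybe; just; nothing)
open import Data.Nat using (zero; _+_; z≤n; s≤s; s≤s⁻¹; NonZero; nonTrivial⇒n>1; _≟_)
open import Data.Nat.Coprimality using (prime⇒coprime; coprime⇒gcd≡1) renaming (sym to coprime-sym)
open import Data.Nat.Divisibility using (divides; ∣1⇒≡1)
open import Data.Nat.DivMod using (_%_; _mod_; %-distribˡ-+; [m+n]%n≡m%n; m<n⇒m%n≡m; m%n<n; m%n%n≡m%n)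
open import Data.Nat.GCD using (gcd; gcd-GCD; module Bézout)
open import Data.Nat.Primality using (prime⇒nonTrivial; prime⇒nonZero)
open import Data.Nat.Properties
import Data.Nat.Solver
open import Data.Product using (∃; ∃₂; _,_; proj₁; proj₂)
open import Data.Sum using (inj₁; inj₂)
import Data.Vec as Vec
open import Data.Vec using ([]; _∷_; lookup)
import Data.Vec.Properties as Vec
open import Data.Vec.Relation.Binary.Pointwise.Inductive as Pointwise using (Pointwise; []; _∷_)
open import Function using (_∘_; id; const; mk⇔)
open import Function.Definitions using (Injective)
open import Relation.Binary.PropositionalEquality using (_≡_; refl; sym; trans; cong; cong₂; subst; module ≡-Reasoning)
open import Relation.Nullary using (Dec; yes; no; does)
open import Relation.Nullary.Decidable using (map′; _⊎-dec_; _×-dec_; ¬?; does-⇔; dec-true)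
open import Relation.Nullary.Negation using (contradiction)
open import Relation.Unary using (Decidable)

-- Finite sums

Σ< : ℕ → (ℕ → ℤ) → ℤ
Σ< zero    h = 0ℤ
Σ< (suc n) h = Σ< n h +ᶻ h n

Σ<-cong-< : ∀ n {h h′ : ℕ → ℤ} → (∀ a → a < n → h a ≡ h′ a) → Σ< n h ≡ Σ< n h′
Σ<-cong-< zero    eq = refl
Σ<-cong-< (suc n) eq = cong₂ _+ᶻ_ (Σ<-cong-< n (λ a a<n → eq a (m<n⇒m<1+n a<n))) (eq n (n<1+n n))

Σ<-cong : ∀ n {h h′ : ℕ → ℤ} → (∀ a → h a ≡ h′ a) → Σ< n h ≡ Σ< n h′
Σ<-cong n eq = Σ<-cong-< n (λ a _ → eq a)

Σ<-minus : ∀ n (h h′ : ℕ → ℤ) → Σ< n (λ a → h a -ᶻ h′ a) ≡ Σ< n h -ᶻ Σ< n h′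
Σ<-minus zero    h h′ = refl
Σ<-minus (suc n) h h′ = trans (cong (_+ᶻ (h n -ᶻ h′ n)) (Σ<-minus n h h′)) (lemma (Σ< n h) (Σ< n h′) (h n) (h′ n))
  where
  lemma : ∀ a b c e → (a -ᶻ b) +ᶻ (c -ᶻ e) ≡ (a +ᶻ c) -ᶻ (b +ᶻ e)
  lemma = solve-∀

Σ<-*ʳ : ∀ n (h : ℕ → ℤ) w → Σ< n (λ a → h a *ᶻ w) ≡ Σ< n h *ᶻ w
Σ<-*ʳ zero    h w = refl
Σ<-*ʳ (suc n) h w = trans (cong (_+ᶻ h n *ᶻ w) (Σ<-*ʳ n h w)) (sym (ℤₚ.*-distribʳ-+ w (Σ< n h) (h n)))

Σ<-const : ∀ n w → Σ< n (const w) ≡ + n *ᶻ w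
Σ<-const zero    w = refl
Σ<-const (suc n) w = trans (cong (_+ᶻ w) (Σ<-const n w)) (lemma (+ n) w)
  where
  lemma : ∀ m w → m *ᶻ w +ᶻ w ≡ (1ℤ +ᶻ m) *ᶻ w
  lemma = solve-∀

Σ<-zero : ∀ n {h : ℕ → ℤ} → (∀ a → a < n → h a ≡ 0ℤ) → Σ< n h ≡ 0ℤ
Σ<-zero n h≡0 = trans (Σ<-cong-< n h≡0) (trans (Σ<-const n 0ℤ) (ℤₚ.*-zeroʳ (+ n)))

Σ<-shift : ∀ n (h : ℕ → ℤ) → Σ< n (h ∘ suc) ≡ Σ< n h +ᶻ (h n -ᶻ h 0)
Σ<-shift zero    h = lemma (h 0)
  where
  lemma : ∀ a → 0ℤ ≡ 0ℤ +ᶻ (a -ᶻ a)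
  lemma = solve-∀
Σ<-shift (suc n) h = trans (cong (_+ᶻ h (suc n)) (Σ<-shift n h)) (lemma (Σ< n h) (h n) (h 0) (h (suc n)))
  where
  lemma : ∀ a b c e → (a +ᶻ (b -ᶻ c)) +ᶻ e ≡ (a +ᶻ b) +ᶻ (e -ᶻ c)
  lemma = solve-∀

-- A sum over a full period does not depend on its starting point. This provides the invariance of
-- sums over ℤ/p under rotation.
Σ<-cyclic : ∀ n {h : ℕ → ℤ} → h n ≡ h 0 → Σ< n (h ∘ suc) ≡ Σ< n h
Σ<-cyclic n {h} eq = trans (Σ<-shift n h) (trans (cong (λ t → Σ< n h +ᶻ (t -ᶻ h 0)) eq) (lemma (Σ< n h) (h 0)))
  where
  lemma : ∀ a b → a +ᶻ (b -ᶻ b) ≡ a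
  lemma = solve-∀

-- Cochains and prism operators

-- A single function on lists carries cochains of all degrees: degree k is its
-- restriction to lists of length k + 1, and [] has degree -1 (augmentation).
Cochain : Set → Set
Cochain X = List X → ℤ

private variable
  X Y : Set

-- The simplicial coboundary, by recursion on the first vertex: dropping it gives `φ xs`, and
-- dropping a later one is a face for the cochain `φ ∘ (x ∷_)`, with the opposite sign. On a
-- one-vertex list it returns the augmentation value `φ []`.
d : Cochain X → Cochain X
d φ []       = 0ℤ
d φ (x ∷ xs) = φ xs -ᶻ d (φ ∘ (x ∷_)) xs

d-+ : (φ ψ : Cochain X) → ∀ xs → d (λ ys → φ ys +ᶻ ψ ys) xs ≡ d φ xs +ᶻ d ψ xs
d-+ φ ψ []       = refl
d-+ φ ψ (x ∷ xs) = trans (cong ((φ xs +ᶻ ψ xs) -ᶻ_) (d-+ (φ ∘ (x ∷_)) (ψ ∘ (x ∷_)) xs))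
  (lemma (φ xs) (ψ xs) (d (φ ∘ (x ∷_)) xs) (d (ψ ∘ (x ∷_)) xs))
  where
  lemma : ∀ a b c e → (a +ᶻ b) -ᶻ (c +ᶻ e) ≡ (a -ᶻ c) +ᶻ (b -ᶻ e)
  lemma = solve-∀

d-*ˡ : ∀ w (φ : Cochain X) xs → d (λ ys → w *ᶻ φ ys) xs ≡ w *ᶻ d φ xs
d-*ˡ w φ []       = sym (ℤₚ.*-zeroʳ w)
d-*ˡ w φ (x ∷ xs) = trans (cong (w *ᶻ φ xs -ᶻ_) (d-*ˡ w (φ ∘ (x ∷_)) xs)) (lemma w (φ xs) (d (φ ∘ (x ∷_)) xs))
  where
  lemma : ∀ w a b → w *ᶻ a -ᶻ w *ᶻ b ≡ w *ᶻ (a -ᶻ b)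
  lemma = solve-∀

d-minus : (φ ψ : Cochain X) → ∀ xs → d (λ ys → φ ys -ᶻ ψ ys) xs ≡ d φ xs -ᶻ d ψ xs
d-minus φ ψ []       = refl
d-minus φ ψ (x ∷ xs) = trans (cong ((φ xs -ᶻ ψ xs) -ᶻ_) (d-minus (φ ∘ (x ∷_)) (ψ ∘ (x ∷_)) xs))
  (lemma (φ xs) (ψ xs) (d (φ ∘ (x ∷_)) xs) (d (ψ ∘ (x ∷_)) xs))
  where
  lemma : ∀ a b c e → (a -ᶻ b) -ᶻ (c -ᶻ e) ≡ (a -ᶻ c) -ᶻ (b -ᶻ e)
  lemma = solve-∀

d-zero : ∀ (xs : List X) → d (const 0ℤ) xs ≡ 0ℤ
d-zero []       = refl
d-zero (x ∷ xs) = cong (0ℤ -ᶻ_) (d-zero xs)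

d-natural : (e : X → Y) (φ : Cochain Y) → ∀ xs → d (φ ∘ map e) xs ≡ d φ (map e xs)
d-natural e φ []       = refl
d-natural e φ (x ∷ xs) = cong (φ (map e xs) -ᶻ_) (d-natural e (φ ∘ (e x ∷_)) xs)

d-d : (φ : Cochain X) → ∀ xs → d (d φ) xs ≡ 0ℤ
d-d φ []       = refl
d-d φ (x ∷ xs) = begin
  d φ xs -ᶻ d (λ ys → φ ys -ᶻ d (φ ∘ (x ∷_)) ys) xs    ≡⟨ cong (d φ xs -ᶻ_) (d-minus φ (d (φ ∘ (x ∷_))) xs) ⟩
  d φ xs -ᶻ (d φ xs -ᶻ d (d (φ ∘ (x ∷_))) xs)          ≡⟨ cong (λ t → d φ xs -ᶻ (d φ xs -ᶻ t)) (d-d (φ ∘ (x ∷_)) xs) ⟩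
  d φ xs -ᶻ (d φ xs -ᶻ 0ℤ)                             ≡⟨ lemma (d φ xs) ⟩
  0ℤ                                                   ∎
  where
  open ≡-Reasoning
  lemma : ∀ a → a -ᶻ (a -ᶻ 0ℤ) ≡ 0ℤ
  lemma = solve-∀

d-Σ< : ∀ n (φ : ℕ → Cochain X) xs → d (λ ys → Σ< n (λ a → φ a ys)) xs ≡ Σ< n (λ a → d (φ a) xs)
d-Σ< zero    φ xs = d-zero xs
d-Σ< (suc n) φ xs = trans (d-+ (λ ys → Σ< n (λ a → φ a ys)) (φ n) xs) (cong (_+ᶻ d (φ n) xs) (d-Σ< n φ xs))

module _ (a b : X → Y) where

  -- The alternating sum, over the vertices of the list, of `φ` at the list that follows `a` up to
  -- this vertex and `b` from this vertex on.
  prism : Cochain Y → Cochain X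
  prism φ []       = 0ℤ
  prism φ (x ∷ xs) = φ (a x ∷ b x ∷ map b xs) -ᶻ prism (φ ∘ (a x ∷_)) xs

  prism-minus : (φ ψ : Cochain Y) → ∀ xs → prism (λ ys → φ ys -ᶻ ψ ys) xs ≡ prism φ xs -ᶻ prism ψ xs
  prism-minus φ ψ []       = refl
  prism-minus φ ψ (x ∷ xs) = trans
    (cong ((φ zs -ᶻ ψ zs) -ᶻ_) (prism-minus (φ ∘ (a x ∷_)) (ψ ∘ (a x ∷_)) xs))
    (lemma (φ zs) (ψ zs) (prism (φ ∘ (a x ∷_)) xs) (prism (ψ ∘ (a x ∷_)) xs))
    where
    zs = a x ∷ b x ∷ map b xs
    lemma : ∀ a b c e → (a -ᶻ b) -ᶻ (c -ᶻ e) ≡ (a -ᶻ c) -ᶻ (b -ᶻ e)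
    lemma = solve-∀

  -- Induction on the first vertex. The coboundary of `φₐᵦ` and the value `prism φ xs` occur in both
  -- summands with opposite signs; what remains is the homotopy for `φₐ` and `u - v`, and these
  -- telescope.
  prism-homotopy : (φ : Cochain Y) → ∀ xs → d (prism φ) xs +ᶻ prism (d φ) xs ≡ φ (map b xs) -ᶻ φ (map a xs)
  prism-homotopy φ []       = lemma (φ [])
    where
    lemma : ∀ a → 0ℤ ≡ a -ᶻ a
    lemma = solve-∀
  prism-homotopy φ (x ∷ xs) = begin
    (prism φ xs -ᶻ d (λ ys → φ (a x ∷ b x ∷ map b ys) -ᶻ prism φₐ ys) xs)
      +ᶻ ((φ (b x ∷ map b xs) -ᶻ (φ (a x ∷ map b xs) -ᶻ d φₐᵦ (map b xs))) -ᶻ prism (λ ys → φ ys -ᶻ d φₐ ys) xs)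
        ≡⟨ cong₂ (λ s t → (prism φ xs -ᶻ s) +ᶻ ((u -ᶻ (v -ᶻ d φₐᵦ (map b xs))) -ᶻ t))
             (trans (d-minus (φₐᵦ ∘ map b) (prism φₐ) xs) (cong (_-ᶻ d (prism φₐ) xs) (d-natural b φₐᵦ xs)))
             (prism-minus φ (d φₐ) xs) ⟩
    (prism φ xs -ᶻ (d φₐᵦ (map b xs) -ᶻ d (prism φₐ) xs))
      +ᶻ ((u -ᶻ (v -ᶻ d φₐᵦ (map b xs))) -ᶻ (prism φ xs -ᶻ prism (d φₐ) xs))
        ≡⟨ lemma (prism φ xs) (d φₐᵦ (map b xs)) (d (prism φₐ) xs) u v (prism (d φₐ) xs) ⟩
    (u -ᶻ v) +ᶻ (d (prism φₐ) xs +ᶻ prism (d φₐ) xs)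
        ≡⟨ cong ((u -ᶻ v) +ᶻ_) (prism-homotopy φₐ xs) ⟩
    (u -ᶻ v) +ᶻ (v -ᶻ φ (a x ∷ map a xs))
        ≡⟨ lemma₂ u v (φ (a x ∷ map a xs)) ⟩
    u -ᶻ φ (a x ∷ map a xs) ∎
    where
    open ≡-Reasoning
    φₐ  = φ ∘ (a x ∷_)
    φₐᵦ = φₐ ∘ (b x ∷_)
    u   = φ (b x ∷ map b xs)
    v   = φ (a x ∷ map b xs)
    lemma : ∀ P D E u v F → (P -ᶻ (D -ᶻ E)) +ᶻ ((u -ᶻ (v -ᶻ D)) -ᶻ (P -ᶻ F)) ≡ (u -ᶻ v) +ᶻ (E +ᶻ F)
    lemma = solve-∀
    lemma₂ : ∀ u v w → (u -ᶻ v) +ᶻ (v -ᶻ w) ≡ u -ᶻ w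
    lemma₂ = solve-∀

  -- The simplices of the prism over a list, that is, the only places where `prism φ` evaluates `φ`.
  data Prismatic : List X → List Y → Set where
    here  : ∀ {x xs}    → Prismatic (x ∷ xs) (a x ∷ b x ∷ map b xs)
    there : ∀ {x xs ys} → Prismatic xs ys → Prismatic (x ∷ xs) (a x ∷ ys)

  prism-vanishes : ∀ {φ : Cochain Y} xs → (∀ ys → Prismatic xs ys → φ ys ≡ 0ℤ) → prism φ xs ≡ 0ℤ
  prism-vanishes []       φ≡0 = refl
  prism-vanishes (x ∷ xs) φ≡0 = cong₂ _-ᶻ_ (φ≡0 _ here) (prism-vanishes xs (λ ys q → φ≡0 _ (there q)))

-- Cochains with a ℤ/p-action

-- The unit law follows from periodicity, because 0 is absorbed when added to `p`.
act-zero : {X : Set} (p : ℕ) (act : ℕ → X → X) → (∀ a b x → act a (act b x) ≡ act (b + a) x) →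
  (∀ x → act p x ≡ x) → ∀ x → act 0 x ≡ x
act-zero p act act-act act-p x = begin
  act 0 x          ≡⟨ cong (act 0) (act-p x) ⟨
  act 0 (act p x)  ≡⟨ act-act 0 p x ⟩
  act (p + 0) x    ≡⟨ cong (λ m → act m x) (+-identityʳ p) ⟩
  act p x          ≡⟨ act-p x ⟩
  x                ∎
  where open ≡-Reasoning

module PartitionOfUnity {X : Set} (p : ℕ) (act : ℕ → X → X)
  (act-act : ∀ a b x → act a (act b x) ≡ act (b + a) x) (act-p : ∀ x → act p x ≡ x)
  (f : X → ℤ) (Good : X → Set) (Good-act : ∀ a {x} → Good x → Good (act a x))
  (Σf≡1 : ∀ {x} → Good x → Σ< p (λ a → f (act a x)) ≡ 1ℤ)
  where

  open ≡-Reasoning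

  act-0 : ∀ x → act 0 x ≡ x
  act-0 = act-zero p act act-act act-p

  shift : ℕ → Cochain X → Cochain X
  shift a φ xs = φ (map (act a) xs)

  -- With `g` the generator of ℤ/p, these are the group ring elements `1 + g + … + g^(p-1)` and
  -- `g - 1`, whose product is 0.
  N τ : Cochain X → Cochain X
  N φ xs = Σ< p (λ a → shift a φ xs)
  τ φ xs = shift 1 φ xs -ᶻ φ xs

  shift-cycle : ∀ (φ : Cochain X) xs → shift p φ xs ≡ shift 0 φ xs
  shift-cycle φ xs = cong φ (map-cong (λ x → trans (act-p x) (sym (act-0 x))) xs)

  map-act-act : ∀ a b xs → map (act a) (map (act b) xs) ≡ map (act (b + a)) xs
  map-act-act a b xs = trans (sym (map-∘ xs)) (map-cong (act-act a b) xs)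

  N-τ : ∀ φ xs → N (τ φ) xs ≡ 0ℤ
  N-τ φ xs = begin
    Σ< p (λ a → φ (map (act 1) (map (act a) xs)) -ᶻ φ (map (act a) xs))
      ≡⟨ Σ<-cong p (λ a → cong (λ ys → φ ys -ᶻ φ (map (act a) xs))
           (trans (map-act-act 1 a xs) (cong (λ m → map (act m) xs) (+-comm a 1)))) ⟩
    Σ< p (λ a → shift (suc a) φ xs -ᶻ shift a φ xs)
      ≡⟨ Σ<-minus p (λ a → shift (suc a) φ xs) (λ a → shift a φ xs) ⟩
    Σ< p (λ a → shift (suc a) φ xs) -ᶻ N φ xs
      ≡⟨ cong (_-ᶻ N φ xs) (Σ<-cyclic p {λ a → shift a φ xs} (shift-cycle φ xs)) ⟩
    N φ xs -ᶻ N φ xs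
      ≡⟨ ℤₚ.i≡j⇒i-j≡0 {N φ xs} refl ⟩
    0ℤ ∎

  N-invariant : ∀ φ xs → N φ (map (act 1) xs) ≡ N φ xs
  N-invariant φ xs = trans
    (Σ<-cong p (λ a → cong φ (map-act-act a 1 xs)))
    (Σ<-cyclic p {λ a → shift a φ xs} (shift-cycle φ xs))

  d-N : ∀ φ xs → d (N φ) xs ≡ N (d φ) xs
  d-N φ xs = trans (d-Σ< p (λ a → shift a φ) xs) (Σ<-cong p (λ a → d-natural (act a) φ xs))

  d-τ : ∀ φ xs → d (τ φ) xs ≡ τ (d φ) xs
  d-τ φ xs = trans (d-minus (shift 1 φ) φ xs) (cong (_-ᶻ d φ xs) (d-natural (act 1) φ xs))

  partial : ℕ → X → X → ℤ
  partial b x y = Σ< b (λ a → f (act a y) -ᶻ f (act a x))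

  -- Solves τ F₁ = d f: since N (d f) = d 1 = 0, the partial sums of the orbit of
  -- d f are periodic, and averaging them against f inverts τ.
  F₁ : X → X → ℤ
  F₁ x y = neg (Σ< p (λ b → partial b x y *ᶻ f (act b x)))

  -- Rotation replaces the partial sum at `b` by the one at `suc b`, minus `ψ`. The sum of the
  -- products is cyclic in `b`, so the only change comes from `ψ`, whose coefficients `f (act b x)`
  -- add up to 1.
  F₁-τ : ∀ {x y} → Good x → Good y → F₁ (act 1 x) (act 1 y) ≡ F₁ x y +ᶻ (f y -ᶻ f x)
  F₁-τ {x} {y} gx gy = begin
    neg (Σ< p (λ b → partial b (act 1 x) (act 1 y) *ᶻ f (act b (act 1 x))))
      ≡⟨ cong neg (Σ<-cong p (λ b → cong₂ _*ᶻ_ (partial-act b) (cong f (act-act b 1 x)))) ⟩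
    neg (Σ< p (λ b → (A (suc b) -ᶻ ψ) *ᶻ fx (suc b)))
      ≡⟨ cong neg (Σ<-cong p (λ b → expand (A (suc b)) ψ (fx (suc b)))) ⟩
    neg (Σ< p (λ b → A (suc b) *ᶻ fx (suc b) -ᶻ fx (suc b) *ᶻ ψ))
      ≡⟨ cong neg (Σ<-minus p (λ b → A (suc b) *ᶻ fx (suc b)) (λ b → fx (suc b) *ᶻ ψ)) ⟩
    neg (Σ< p (λ b → A (suc b) *ᶻ fx (suc b)) -ᶻ Σ< p (λ b → fx (suc b) *ᶻ ψ))
      ≡⟨ cong₂ (λ s t → neg (s -ᶻ t))
           (Σ<-cyclic p {λ b → A b *ᶻ fx b} (cong (_*ᶻ fx p) A-p))
           (trans (Σ<-*ʳ p (fx ∘ suc) ψ) (cong (_*ᶻ ψ) (trans (Σ<-cyclic p {fx} fx-cycle) (Σf≡1 gx)))) ⟩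
    neg (Σ< p (λ b → A b *ᶻ fx b) -ᶻ 1ℤ *ᶻ ψ)
      ≡⟨ finish (Σ< p (λ b → A b *ᶻ fx b)) (f y) (f x) ⟩
    F₁ x y +ᶻ ψ ∎
    where
    ψ = f y -ᶻ f x
    A : ℕ → ℤ
    A b = partial b x y
    fx : ℕ → ℤ
    fx b = f (act b x)
    fx-cycle : fx p ≡ fx 0
    fx-cycle = cong f (trans (act-p x) (sym (act-0 x)))
    -- Both orbits have sum 1, so the partial sums return to 0 after one period.
    A-p : A p ≡ 0ℤ
    A-p = trans (Σ<-minus p (λ a → f (act a y)) fx) (cong₂ _-ᶻ_ (Σf≡1 gy) (Σf≡1 gx))
    partial-act : ∀ b → partial b (act 1 x) (act 1 y) ≡ A (suc b) -ᶻ ψ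
    partial-act b = begin
      Σ< b (λ a → f (act a (act 1 y)) -ᶻ f (act a (act 1 x)))
        ≡⟨ Σ<-cong b (λ a → cong₂ (λ s t → f s -ᶻ f t) (act-act a 1 y) (act-act a 1 x)) ⟩
      Σ< b (λ a → f (act (suc a) y) -ᶻ f (act (suc a) x))
        ≡⟨ Σ<-shift b (λ a → f (act a y) -ᶻ f (act a x)) ⟩
      A b +ᶻ ((f (act b y) -ᶻ f (act b x)) -ᶻ (f (act 0 y) -ᶻ f (act 0 x)))
        ≡⟨ cong₂ (λ s t → A b +ᶻ ((f (act b y) -ᶻ f (act b x)) -ᶻ (f s -ᶻ f t))) (act-0 y) (act-0 x) ⟩
      A b +ᶻ ((f (act b y) -ᶻ f (act b x)) -ᶻ ψ)
        ≡⟨ reassoc (A b) (f (act b y) -ᶻ f (act b x)) ψ ⟩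
      A (suc b) -ᶻ ψ ∎
      where
      reassoc : ∀ s t u → s +ᶻ (t -ᶻ u) ≡ (s +ᶻ t) -ᶻ u
      reassoc = solve-∀
    expand : ∀ s t u → (s -ᶻ t) *ᶻ u ≡ s *ᶻ u -ᶻ u *ᶻ t
    expand = solve-∀
    finish : ∀ s a b → neg (s -ᶻ 1ℤ *ᶻ (a -ᶻ b)) ≡ neg s +ᶻ (a -ᶻ b)
    finish = solve-∀

  F₁-vanishes : ∀ {x y} → (∀ a → a < p → f (act a x) ≡ f (act a y)) → F₁ x y ≡ 0ℤ
  F₁-vanishes {x} {y} eq = cong neg (Σ<-zero p λ b b<p → cong (_*ᶻ f (act b x))
    (Σ<-zero b λ a a<b → ℤₚ.i≡j⇒i-j≡0 (sym (eq a (<-trans a<b b<p)))))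

  -- The coboundary of `F₁`. Since `τ F₁` is itself a coboundary, `B` is invariant although `F₁` is
  -- not.
  B : X → X → X → ℤ
  B x y z = (F₁ y z -ᶻ F₁ x z) +ᶻ F₁ x y

  B-invariant : ∀ {x y z} → Good x → Good y → Good z → B (act 1 x) (act 1 y) (act 1 z) ≡ B x y z
  B-invariant {x} {y} {z} gx gy gz
    rewrite F₁-τ gy gz | F₁-τ gx gz | F₁-τ gx gy = lemma (F₁ y z) (F₁ x z) (F₁ x y) (f x) (f y) (f z)
    where
    lemma : ∀ a b c x y z → ((a +ᶻ (z -ᶻ y)) -ᶻ (b +ᶻ (z -ᶻ x))) +ᶻ (c +ᶻ (y -ᶻ x)) ≡ (a -ᶻ b) +ᶻ c
    lemma = solve-∀

  -- Cup products and powers of the generator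

  f∪_ F₁∪_ : Cochain X → Cochain X
  (f∪ φ) []        = 0ℤ
  (f∪ φ) (x ∷ xs)  = f x *ᶻ φ (x ∷ xs)
  (F₁∪ φ) (x ∷ y ∷ ys) = F₁ x y *ᶻ φ (y ∷ ys)
  (F₁∪ φ) _            = 0ℤ

  module _ (φ : Cochain X) (dφ≡0 : ∀ xs → d φ xs ≡ 0ℤ) where

    -- The Leibniz rule: the term containing `d φ` drops out because `φ` is a cocycle.
    d-f∪ : ∀ x y ys → d (f∪ φ) (x ∷ y ∷ ys) ≡ (f y -ᶻ f x) *ᶻ φ (y ∷ ys)
    d-f∪ x y ys = begin
      f y *ᶻ φ (y ∷ ys) -ᶻ (f x *ᶻ φ (x ∷ ys) -ᶻ d (λ zs → f x *ᶻ φ (x ∷ y ∷ zs)) ys)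
        ≡⟨ cong (λ t → f y *ᶻ φ (y ∷ ys) -ᶻ (f x *ᶻ φ (x ∷ ys) -ᶻ t)) (d-*ˡ (f x) (λ zs → φ (x ∷ y ∷ zs)) ys) ⟩
      f y *ᶻ φ (y ∷ ys) -ᶻ (f x *ᶻ φ (x ∷ ys) -ᶻ f x *ᶻ D)
        ≡⟨ regroup (f x) (f y) (φ (y ∷ ys)) (φ (x ∷ ys)) D ⟩
      (f y -ᶻ f x) *ᶻ φ (y ∷ ys) +ᶻ f x *ᶻ d φ (x ∷ y ∷ ys)
        ≡⟨ cong (λ t → (f y -ᶻ f x) *ᶻ φ (y ∷ ys) +ᶻ f x *ᶻ t) (dφ≡0 (x ∷ y ∷ ys)) ⟩
      (f y -ᶻ f x) *ᶻ φ (y ∷ ys) +ᶻ f x *ᶻ 0ℤ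
        ≡⟨ drop ((f y -ᶻ f x) *ᶻ φ (y ∷ ys)) (f x) ⟩
      (f y -ᶻ f x) *ᶻ φ (y ∷ ys) ∎
      where
      D = d (λ zs → φ (x ∷ y ∷ zs)) ys
      regroup : ∀ a b u v D → b *ᶻ u -ᶻ (a *ᶻ v -ᶻ a *ᶻ D) ≡ (b -ᶻ a) *ᶻ u +ᶻ a *ᶻ (u -ᶻ (v -ᶻ D))
      regroup = solve-∀
      drop : ∀ s a → s +ᶻ a *ᶻ 0ℤ ≡ s
      drop = solve-∀

    d-F₁∪ : ∀ x y z zs → d (F₁∪ φ) (x ∷ y ∷ z ∷ zs) ≡ B x y z *ᶻ φ (z ∷ zs)
    d-F₁∪ x y z zs = begin
      F₁ y z *ᶻ w -ᶻ (F₁ x z *ᶻ w -ᶻ d (λ ws → F₁ x y *ᶻ φ (y ∷ ws)) (z ∷ zs))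
        ≡⟨ cong (λ t → F₁ y z *ᶻ w -ᶻ (F₁ x z *ᶻ w -ᶻ t)) (d-*ˡ (F₁ x y) (φ ∘ (y ∷_)) (z ∷ zs)) ⟩
      F₁ y z *ᶻ w -ᶻ (F₁ x z *ᶻ w -ᶻ F₁ x y *ᶻ D)
        ≡⟨ regroup (F₁ y z) (F₁ x z) (F₁ x y) w D ⟩
      B x y z *ᶻ w -ᶻ F₁ x y *ᶻ d φ (y ∷ z ∷ zs)
        ≡⟨ cong (λ t → B x y z *ᶻ w -ᶻ F₁ x y *ᶻ t) (dφ≡0 (y ∷ z ∷ zs)) ⟩
      B x y z *ᶻ w -ᶻ F₁ x y *ᶻ 0ℤ
        ≡⟨ drop (B x y z *ᶻ w) (F₁ x y) ⟩
      B x y z *ᶻ w ∎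
      where
      w = φ (z ∷ zs)
      D = d (φ ∘ (y ∷_)) (z ∷ zs)
      regroup : ∀ a b c w D → a *ᶻ w -ᶻ (b *ᶻ w -ᶻ c *ᶻ D) ≡ ((a -ᶻ b) +ᶻ c) *ᶻ w -ᶻ c *ᶻ (w -ᶻ D)
      regroup = solve-∀
      drop : ∀ s a → s -ᶻ a *ᶻ 0ℤ ≡ s
      drop = solve-∀

  -- W k represents the k-th power of the generator of the second cohomology of ℤ/p.
  W : ℕ → Cochain X
  W zero    (_ ∷ []) = 1ℤ
  W zero    _        = 0ℤ
  W (suc k)          = d (F₁∪ W k)

  W-cocycle : ∀ k xs → d (W k) xs ≡ 0ℤ
  W-cocycle zero    []               = refl
  W-cocycle zero    (x ∷ [])         = refl
  W-cocycle zero    (x ∷ y ∷ [])     = refl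
  W-cocycle zero    (x ∷ y ∷ z ∷ zs) = cong (λ t → 0ℤ -ᶻ (0ℤ -ᶻ (0ℤ -ᶻ t))) (d-zero zs)
  W-cocycle (suc k) xs               = d-d (F₁∪ W k) xs

  -- Unfolded completely, this writes `W k` as a product of values of `B` over triples in which
  -- neighbours share one vertex. Invariance and vanishing of `W` can then be read off from the
  -- factors.
  W-suc : ∀ k x y z zs → W (suc k) (x ∷ y ∷ z ∷ zs) ≡ B x y z *ᶻ W k (z ∷ zs)
  W-suc k = d-F₁∪ (W k) (W-cocycle k)

  W-invariant₁ : ∀ k {xs} → All Good xs → W k (map (act 1) xs) ≡ W k xs
  W-invariant₁ zero    []            = refl
  W-invariant₁ zero    (_ ∷ [])      = refl
  W-invariant₁ zero    (_ ∷ _ ∷ _)   = refl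
  W-invariant₁ (suc k) []            = refl
  W-invariant₁ (suc k) (_ ∷ [])      = refl
  W-invariant₁ (suc k) (_ ∷ _ ∷ [])  = refl
  W-invariant₁ (suc k) {x ∷ y ∷ z ∷ zs} (gx ∷ gy ∷ gz ∷ gzs) = begin
    W (suc k) (act 1 x ∷ act 1 y ∷ act 1 z ∷ map (act 1) zs)
      ≡⟨ W-suc k (act 1 x) (act 1 y) (act 1 z) (map (act 1) zs) ⟩
    B (act 1 x) (act 1 y) (act 1 z) *ᶻ W k (map (act 1) (z ∷ zs))
      ≡⟨ cong₂ _*ᶻ_ (B-invariant gx gy gz) (W-invariant₁ k (gz ∷ gzs)) ⟩
    B x y z *ᶻ W k (z ∷ zs)
      ≡⟨ W-suc k x y z zs ⟨
    W (suc k) (x ∷ y ∷ z ∷ zs) ∎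

  All-Good-act : ∀ a {xs} → All Good xs → All Good (map (act a) xs)
  All-Good-act a gs = All.map⁺ (All.map (Good-act a) gs)

  W-invariant : ∀ k a {xs} → All Good xs → W k (map (act a) xs) ≡ W k xs
  W-invariant k zero    {xs} gs = cong (W k) (trans (map-cong act-0 xs) (map-id xs))
  W-invariant k (suc a) {xs} gs = begin
    W k (map (act (suc a)) xs)          ≡⟨ cong (W k) (map-act-act a 1 xs) ⟨
    W k (map (act a) (map (act 1) xs))  ≡⟨ W-invariant k a (All-Good-act 1 gs) ⟩
    W k (map (act 1) xs)                ≡⟨ W-invariant₁ k gs ⟩
    W k xs                              ∎

  -- Since `W k` is invariant, `τ` acts on the factor `F₁` alone and turns it into `d f`; the
  -- Leibniz rule does the rest.
  τ-F₁∪W : ∀ k {xs} → All Good xs → τ (F₁∪ W k) xs ≡ d (f∪ W k) xs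
  τ-F₁∪W k []       = refl
  τ-F₁∪W k (_ ∷ []) = refl
  τ-F₁∪W k {x ∷ y ∷ ys} (gx ∷ gy ∷ gys) = begin
    F₁ (act 1 x) (act 1 y) *ᶻ W k (map (act 1) (y ∷ ys)) -ᶻ F₁ x y *ᶻ W k (y ∷ ys)
      ≡⟨ cong₂ (λ s t → s *ᶻ t -ᶻ F₁ x y *ᶻ W k (y ∷ ys)) (F₁-τ gx gy) (W-invariant₁ k (gy ∷ gys)) ⟩
    (F₁ x y +ᶻ (f y -ᶻ f x)) *ᶻ W k (y ∷ ys) -ᶻ F₁ x y *ᶻ W k (y ∷ ys)
      ≡⟨ lemma (F₁ x y) (f y -ᶻ f x) (W k (y ∷ ys)) ⟩
    (f y -ᶻ f x) *ᶻ W k (y ∷ ys)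
      ≡⟨ d-f∪ (W k) (W-cocycle k) x y ys ⟨
    d (f∪ W k) (x ∷ y ∷ ys) ∎
    where
    lemma : ∀ a b w → (a +ᶻ b) *ᶻ w -ᶻ a *ᶻ w ≡ b *ᶻ w
    lemma = solve-∀

  -- Since `W k` is invariant, the norm acts on the factor `f` alone, whose orbit sum is 1.
  N-f∪W : ∀ k {x xs} → All Good (x ∷ xs) → N (f∪ W k) (x ∷ xs) ≡ W k (x ∷ xs)
  N-f∪W k {x} {xs} gs@(gx ∷ _) = begin
    Σ< p (λ a → f (act a x) *ᶻ W k (map (act a) (x ∷ xs)))
      ≡⟨ Σ<-cong p (λ a → cong (f (act a x) *ᶻ_) (W-invariant k a gs)) ⟩
    Σ< p (λ a → f (act a x) *ᶻ W k (x ∷ xs))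
      ≡⟨ Σ<-*ʳ p (λ a → f (act a x)) (W k (x ∷ xs)) ⟩
    Σ< p (λ a → f (act a x)) *ᶻ W k (x ∷ xs)
      ≡⟨ cong (_*ᶻ W k (x ∷ xs)) (Σf≡1 gx) ⟩
    1ℤ *ᶻ W k (x ∷ xs)
      ≡⟨ ℤₚ.*-identityˡ _ ⟩
    W k (x ∷ xs) ∎

  -- Descent in the degree

  module Descent (Adm : ℕ → List X → Set) (T : ℕ)
    (Adm-act : ∀ {k xs} a → Adm k xs → Adm k (map (act a) xs))
    (Adm-nonempty : ∀ {k} → Adm k [] → ⊥)
    (Adm-Good : ∀ {k xs} → k ≤ T → Adm k xs → All Good xs)
    (exact : ∀ k (φ : Cochain X) → (∀ ys → Adm (suc k) ys → d φ ys ≡ 0ℤ) →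
             ∃ λ G → ∀ xs → Adm k xs → φ xs ≡ d G xs)
    where

    -- Having a primitive carries no information, as `exact` provides one for every cocycle; the
    -- content is that the primitive is a norm. The degree of `W k` is `k * 2`.
    NullCohomologous : ℕ → Set
    NullCohomologous k = ∃ λ G → ∀ xs → Adm (k * 2) xs → W k xs ≡ d (N G) xs

    -- W (suc k) = d (F₁ ∪ W k) = d (N G) makes F₁ ∪ W k - N G exact, say equal to d H;
    -- applying τ turns this into exactness of f ∪ W k - τ H, and applying N finishes.
    descend-step : ∀ k → suc k * 2 ≤ T → NullCohomologous (suc k) → NullCohomologous k
    descend-step k 2k+2≤T (G , W≡dNG) = G′ , W≡dNG′
      where
      lift : ∃ λ H → ∀ xs → Adm (suc (k * 2)) xs → (F₁∪ W k) xs -ᶻ N G xs ≡ d H xs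
      lift = exact (suc (k * 2)) (λ xs → (F₁∪ W k) xs -ᶻ N G xs) λ ys adm →
        trans (d-minus (F₁∪ W k) (N G) ys) (ℤₚ.i≡j⇒i-j≡0 (W≡dNG ys adm))
      H = proj₁ lift

      d[f∪W-τH]≡0 : ∀ ys → Adm (suc (k * 2)) ys → d (λ zs → (f∪ W k) zs -ᶻ τ H zs) ys ≡ 0ℤ
      d[f∪W-τH]≡0 ys adm = trans (d-minus (f∪ W k) (τ H) ys) (ℤₚ.i≡j⇒i-j≡0 (begin
        d (f∪ W k) ys
          ≡⟨ τ-F₁∪W k (Adm-Good (≤-trans (n≤1+n _) 2k+2≤T) adm) ⟨
        (F₁∪ W k) ys⁺ -ᶻ (F₁∪ W k) ys
          ≡⟨ lemma ((F₁∪ W k) ys⁺) ((F₁∪ W k) ys) (N G ys) ⟩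
        ((F₁∪ W k) ys⁺ -ᶻ N G ys) -ᶻ ((F₁∪ W k) ys -ᶻ N G ys)
          ≡⟨ cong (λ t → ((F₁∪ W k) ys⁺ -ᶻ t) -ᶻ ((F₁∪ W k) ys -ᶻ N G ys)) (N-invariant G ys) ⟨
        ((F₁∪ W k) ys⁺ -ᶻ N G ys⁺) -ᶻ ((F₁∪ W k) ys -ᶻ N G ys)
          ≡⟨ cong₂ _-ᶻ_ (proj₂ lift ys⁺ (Adm-act 1 adm)) (proj₂ lift ys adm) ⟩
        τ (d H) ys
          ≡⟨ d-τ H ys ⟨
        d (τ H) ys ∎))
        where
        ys⁺ = map (act 1) ys
        lemma : ∀ a b c → a -ᶻ b ≡ (a -ᶻ c) -ᶻ (b -ᶻ c)
        lemma = solve-∀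

      lift′ : ∃ λ G′ → ∀ xs → Adm (k * 2) xs → (f∪ W k) xs -ᶻ τ H xs ≡ d G′ xs
      lift′ = exact (k * 2) (λ xs → (f∪ W k) xs -ᶻ τ H xs) d[f∪W-τH]≡0
      G′ = proj₁ lift′

      W≡dNG′ : ∀ xs → Adm (k * 2) xs → W k xs ≡ d (N G′) xs
      W≡dNG′ []       adm = ⊥-elim (Adm-nonempty adm)
      W≡dNG′ (x ∷ xs) adm = begin
        W k (x ∷ xs)
          ≡⟨ N-f∪W k (Adm-Good (≤-trans (≤-trans (n≤1+n _) (n≤1+n _)) 2k+2≤T) adm) ⟨
        N (f∪ W k) (x ∷ xs)
          ≡⟨ ℤₚ.+-identityʳ _ ⟨
        N (f∪ W k) (x ∷ xs) -ᶻ 0ℤ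
          ≡⟨ cong (N (f∪ W k) (x ∷ xs) -ᶻ_) (N-τ H (x ∷ xs)) ⟨
        N (f∪ W k) (x ∷ xs) -ᶻ N (τ H) (x ∷ xs)
          ≡⟨ Σ<-minus p (λ a → shift a (f∪ W k) (x ∷ xs)) (λ a → shift a (τ H) (x ∷ xs)) ⟨
        N (λ ys → (f∪ W k) ys -ᶻ τ H ys) (x ∷ xs)
          ≡⟨ Σ<-cong p (λ a → proj₂ lift′ _ (Adm-act a adm)) ⟩
        N (d G′) (x ∷ xs)
          ≡⟨ d-N G′ (x ∷ xs) ⟨
        d (N G′) (x ∷ xs) ∎

    descend : ∀ k → k * 2 ≤ T → NullCohomologous k → NullCohomologous 0
    descend zero    _      nc = nc
    descend (suc k) 2k+2≤T nc =
      descend k (≤-trans (≤-trans (n≤1+n _) (n≤1+n _)) 2k+2≤T) (descend-step k 2k+2≤T nc)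

    -- A primitive of `W 0` has degree -1, so it amounts to the single integer `G []`, on which the
    -- norm is multiplication by `p`.
    ¬NullCohomologous : 2 ≤ p → ∀ {x} → Adm 0 (x ∷ []) → ∀ k → k * 2 ≤ T → NullCohomologous k → ⊥
    ¬NullCohomologous 2≤p {x} adm k 2k≤T nc = 1≢p*m (G []) (begin
      1ℤ                ≡⟨ 1≡dNG (x ∷ []) adm ⟩
      N G [] -ᶻ 0ℤ      ≡⟨ ℤₚ.+-identityʳ _ ⟩
      N G []            ≡⟨ Σ<-const p (G []) ⟩
      + p *ᶻ G []       ∎)
      where
      G = proj₁ (descend k 2k≤T nc)
      1≡dNG = proj₂ (descend k 2k≤T nc)
      1≢p*m : ∀ m → 1ℤ ≡ + p *ᶻ m → ⊥
      1≢p*m m eq = <⇒≢ 2≤p (sym (∣1⇒≡1 (divides (abs m) (trans (cong abs eq) (trans (ℤₚ.abs-* (+ p) m) (*-comm p (abs m)))))))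

-- Acyclicity of the order complex

module Chains {X : Set} (_≼_ : X → X → Set) (rank : X → ℕ) where

  -- Chains may repeat elements, so monotone maps preserve them without being injective. The bound
  -- on the rank grows with the degree because a prism adds one vertex and raises ranks by at most
  -- one.
  record Adm (k : ℕ) (xs : List X) : Set where
    constructor adm
    field
      size  : length xs ≡ suc k
      chain : Linked _≼_ xs
      ranks : All (λ x → rank x ≤ k) xs
  open Adm

  Adm-nonempty : ∀ {k} → ¬ Adm k []
  Adm-nonempty (adm () _ _)

  Monotone : (X → X) → Set
  Monotone e = ∀ {x y} → x ≼ y → e x ≼ e y

  Linked-map : ∀ {e xs} → Monotone e → Linked _≼_ xs → Linked _≼_ (map e xs)
  Linked-map mono = Linked.map⁺ ∘ Linked.map mono

  Adm-map : ∀ {e k xs} → Monotone e → (∀ x → rank (e x) ≤ rank x) → Adm k xs → Adm k (map e xs)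
  Adm-map {e} {xs = xs} mono r (adm s c rs) =
    adm (trans (length-map e xs) s) (Linked-map mono c) (All.map⁺ (All.map (≤-trans (r _)) rs))

  module _ {a b : X → X} (a-mono : Monotone a) (b-mono : Monotone b) (a≼b : ∀ x → a x ≼ b x)
    (rank-a : ∀ x → rank (a x) ≤ rank x) (rank-b : ∀ x → rank (b x) ≤ suc (rank x)) where

    Prismatic-size : ∀ {xs ys} → Prismatic a b xs ys → length ys ≡ suc (length xs)
    Prismatic-size (here {xs = xs}) = cong (λ m → suc (suc m)) (length-map b xs)
    Prismatic-size (there q)        = cong suc (Prismatic-size q)

    Prismatic-chain : ∀ {xs ys} → Linked _≼_ xs → Prismatic a b xs ys → Linked _≼_ ys
    Prismatic-chain c             here              = a≼b _ ∷ Linked-map b-mono c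
    -- Splitting on `q` serves only to expose the head of the remaining list, the image under `a` of
    -- the next vertex.
    Prismatic-chain (x≼y ∷ c)     (there q@here)      = a-mono x≼y ∷ Prismatic-chain c q
    Prismatic-chain (x≼y ∷ c)     (there q@(there _)) = a-mono x≼y ∷ Prismatic-chain c q

    Prismatic-ranks : ∀ {k xs ys} → All (λ x → rank x ≤ k) xs → Prismatic a b xs ys →
                      All (λ x → rank x ≤ suc k) ys
    Prismatic-ranks (r ∷ rs) here      =
      m≤n⇒m≤1+n (≤-trans (rank-a _) r) ∷ All.map⁺ (All.map (λ r → ≤-trans (rank-b _) (s≤s r)) (r ∷ rs))
    Prismatic-ranks (r ∷ rs) (there q) = m≤n⇒m≤1+n (≤-trans (rank-a _) r) ∷ Prismatic-ranks rs q

    -- All simplices of the prism over an admissible chain are admissible one degree higher, so the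
    -- term `prism (d φ)` of the homotopy formula vanishes.
    prism-cocycle : ∀ k {φ} → (∀ ys → Adm (suc k) ys → d φ ys ≡ 0ℤ) →
      ∀ xs → Adm k xs → d (prism a b φ) xs ≡ φ (map b xs) -ᶻ φ (map a xs)
    prism-cocycle k {φ} dφ≡0 xs (adm s c rs) = begin
      d (prism a b φ) xs
        ≡⟨ ℤₚ.+-identityʳ _ ⟨
      d (prism a b φ) xs +ᶻ 0ℤ
        ≡⟨ cong (d (prism a b φ) xs +ᶻ_) (prism-vanishes a b xs λ ys q →
             dφ≡0 ys (adm (trans (Prismatic-size q) (cong suc s)) (Prismatic-chain c q) (Prismatic-ranks rs q))) ⟨
      d (prism a b φ) xs +ᶻ prism a b (d φ) xs
        ≡⟨ prism-homotopy a b φ xs ⟩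
      φ (map b xs) -ᶻ φ (map a xs) ∎
      where open ≡-Reasoning

  -- A zigzag id = Z 0 ≼ S 0 ≽ Z 1 ≼ S 1 ≽ … ≽ Z n = const z contracts the order complex.
  module Contraction (≼-refl : ∀ {x} → x ≼ x) (n : ℕ) (z : X) (Z S : ℕ → X → X)
    (Z-mono : ∀ j → Monotone (Z j)) (S-mono : ∀ j → Monotone (S j))
    (Z≼S : ∀ j x → Z j x ≼ S j x) (Z′≼S : ∀ j x → Z (suc j) x ≼ S j x)
    (rank-Z : ∀ j x → rank (Z j x) ≤ rank x) (rank-S : ∀ j x → rank (S j x) ≤ suc (rank x))
    (Z-start : ∀ x → Z 0 x ≡ x) (Z-end : ∀ x → Z n x ≡ z)
    where

    open ≡-Reasoning

    module _ (k : ℕ) (φ : Cochain X) (dφ≡0 : ∀ ys → Adm (suc k) ys → d φ ys ≡ 0ℤ) where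

      -- Both `Z j` and `Z (suc j)` lie below `S j`, so each is joined to it by a prism; the
      -- difference of the two prisms carries the primitive from `j` to `suc j`.
      zigzag : ∀ j → ∃ λ G → ∀ xs → Adm k xs → φ xs -ᶻ φ (map (Z j) xs) ≡ d G xs
      zigzag zero    = const 0ℤ , λ xs _ → trans
        (ℤₚ.i≡j⇒i-j≡0 (cong φ (sym (trans (map-cong Z-start xs) (map-id xs))))) (sym (d-zero xs))
      zigzag (suc j) = let (G , eq) = zigzag j in
        (λ ys → G ys +ᶻ (P′ ys -ᶻ P ys)) , λ xs q → begin
          φ xs -ᶻ φ (map (Z (suc j)) xs)
            ≡⟨ lemma (φ xs) (φ (map (Z j) xs)) (φ (map (Z (suc j)) xs)) (φ (map (S j) xs)) ⟩
          (φ xs -ᶻ φ (map (Z j) xs)) +ᶻ ((φ (map (S j) xs) -ᶻ φ (map (Z (suc j)) xs)) -ᶻ (φ (map (S j) xs) -ᶻ φ (map (Z j) xs)))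
            ≡⟨ cong₂ _+ᶻ_ (eq xs q) (cong₂ _-ᶻ_
                 (sym (prism-cocycle (Z-mono (suc j)) (S-mono j) (Z′≼S j) (rank-Z (suc j)) (rank-S j) k dφ≡0 xs q))
                 (sym (prism-cocycle (Z-mono j) (S-mono j) (Z≼S j) (rank-Z j) (rank-S j) k dφ≡0 xs q))) ⟩
          d G xs +ᶻ (d P′ xs -ᶻ d P xs)
            ≡⟨ cong (d G xs +ᶻ_) (d-minus P′ P xs) ⟨
          d G xs +ᶻ d (λ ys → P′ ys -ᶻ P ys) xs
            ≡⟨ d-+ G (λ ys → P′ ys -ᶻ P ys) xs ⟨
          d (λ ys → G ys +ᶻ (P′ ys -ᶻ P ys)) xs ∎
        where
        P  = prism (Z j) (S j) φ
        P′ = prism (Z (suc j)) (S j) φ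
        lemma : ∀ a b c e → a -ᶻ c ≡ (a -ᶻ b) +ᶻ ((e -ᶻ c) -ᶻ (e -ᶻ b))
        lemma = solve-∀

      exact : ∃ λ G → ∀ xs → Adm k xs → φ xs ≡ d G xs
      exact = let (G , eq) = zigzag n in
        (λ ys → G ys +ᶻ C ys) , λ xs q → begin
          φ xs
            ≡⟨ lemma (φ xs) (φ (map (Z n) xs)) ⟩
          (φ xs -ᶻ φ (map (Z n) xs)) +ᶻ φ (map (Z n) xs)
            ≡⟨ cong₂ _+ᶻ_ (eq xs q) (cone xs q) ⟩
          d G xs +ᶻ d C xs
            ≡⟨ d-+ G C xs ⟨
          d (λ ys → G ys +ᶻ C ys) xs ∎
        where
        lemma : ∀ a b → a ≡ (a -ᶻ b) +ᶻ b
        lemma = solve-∀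

        -- The cone with apex `z`: as `Z n` is constantly `z`, prepending `z` to an image under
        -- `Z n` keeps it a chain by reflexivity.
        C : Cochain X
        C ys = φ (z ∷ map (Z n) ys)

        z∷-Adm : ∀ xs → Adm k xs → Adm (suc k) (z ∷ map (Z n) xs)
        z∷-Adm (x ∷ xs) q with Adm-map (Z-mono n) (rank-Z n) q
        ... | adm s c rs@(r ∷ _) = adm (cong suc s)
          (subst (_≼ Z n x) (Z-end x) ≼-refl ∷ c)
          (subst (λ t → rank t ≤ suc k) (Z-end x) (m≤n⇒m≤1+n r) ∷ All.map m≤n⇒m≤1+n rs)

        cone : ∀ xs → Adm k xs → φ (map (Z n) xs) ≡ d C xs
        cone xs q = begin
          φ (map (Z n) xs)                                       ≡⟨ lemma (φ (map (Z n) xs)) (d φ₀ (map (Z n) xs)) ⟩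
          d φ (z ∷ map (Z n) xs) +ᶻ d φ₀ (map (Z n) xs)          ≡⟨ cong (_+ᶻ d φ₀ (map (Z n) xs)) (dφ≡0 _ (z∷-Adm xs q)) ⟩
          0ℤ +ᶻ d φ₀ (map (Z n) xs)                              ≡⟨ ℤₚ.+-identityˡ _ ⟩
          d φ₀ (map (Z n) xs)                                    ≡⟨ d-natural (Z n) φ₀ xs ⟨
          d C xs                                                 ∎
          where φ₀ = φ ∘ (z ∷_)

-- Partial words

-- A constructive form of finiteness: existence of an element with a decidable property can be
-- decided. It makes the attached pairs of a partial word Boolean data that can be counted.
Searchable : Set → Set₁
Searchable A = ∀ {P : A → Set} → Decidable P → Dec (∃ P)

Maybe-searchable : ∀ {A} → Searchable A → Searchable (Maybe A)
Maybe-searchable search {P} P? = map′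
  (λ { (inj₁ q) → nothing , q ; (inj₂ (a , q)) → just a , q })
  (λ { (nothing , q) → inj₁ q ; (just a , q) → inj₂ (a , q) })
  (P? nothing ⊎-dec search (P? ∘ just))

Vec-searchable : ∀ {A n} → Searchable A → Searchable (Vec A n)
Vec-searchable {n = zero}  search P? = map′ (λ q → [] , q) (λ { ([] , q) → q }) (P? [])
Vec-searchable {n = suc n} search P? = map′
  (λ { (a , v , q) → a ∷ v , q })
  (λ { (a ∷ v , q) → a , v , q })
  (search λ a → Vec-searchable search λ v → P? (a ∷ v))

-- Here `nothing` is the star and the largest element, since it admits every symbol; distinct
-- symbols are incomparable.
data _⊑_ {A : Set} : Maybe A → Maybe A → Set where
  star : ∀ {m} → m ⊑ nothing
  same : ∀ {a} → just a ⊑ just a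

module _ {A : Set} where

  ⊑-refl : ∀ {m : Maybe A} → m ⊑ m
  ⊑-refl {just _}  = same
  ⊑-refl {nothing} = star

  ⊑-trans : ∀ {l m n : Maybe A} → l ⊑ m → m ⊑ n → l ⊑ n
  ⊑-trans _    star = star
  ⊑-trans same same = same

  ⊑-map : ∀ {B : Set} (h : A → B) {l m : Maybe A} → l ⊑ m → Maybe.map h l ⊑ Maybe.map h m
  ⊑-map h star = star
  ⊑-map h same = same

⊑-dec : ∀ {n} (l m : Maybe (Fin n)) → Dec (l ⊑ m)
⊑-dec l       nothing  = yes star
⊑-dec nothing (just b) = no λ ()
⊑-dec (just a) (just b) with a ≟ᶠ b
... | yes refl = yes same
... | no a≢b   = no λ { same → a≢b refl }

-- A partial word stands for the subcube of all its completions; x ≼ y means that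
-- the subcube of x is contained in that of y.
Partial : ℕ → ℕ → Set
Partial p n = Vec (Maybe (Fin p)) n

_≼_ : ∀ {p n} → Partial p n → Partial p n → Set
_≼_ = Pointwise _⊑_

≼-refl : ∀ {p n} {x : Partial p n} → x ≼ x
≼-refl = Pointwise.refl ⊑-refl

≼-trans : ∀ {p n} {x y z : Partial p n} → x ≼ y → y ≼ z → x ≼ z
≼-trans = Pointwise.trans ⊑-trans

stars : ∀ {p n} → Partial p n → ℕ
stars []            = 0
stars (nothing ∷ x) = suc (stars x)
stars (just _ ∷ x)  = stars x

stars-map : ∀ {p n} (h : Fin p → Fin p) (x : Partial p n) → stars (Vec.map (Maybe.map h) x) ≡ stars x
stars-map h []            = refl
stars-map h (nothing ∷ x) = cong suc (stars-map h x)
stars-map h (just _ ∷ x)  = stars-map h x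

module _ {p : ℕ} (o : Fin p) where

  fill : ∀ {n} → ℕ → Partial p n → Partial p n
  fill zero    x       = x
  fill (suc j) []      = []
  fill (suc j) (_ ∷ x) = just o ∷ fill j x

  -- A common upper bound of `fill j x` and `fill (suc j) x`, which differ at most at coordinate
  -- `j`: the star there covers both the old entry and `o`.
  blur : ∀ {n} → ℕ → Partial p n → Partial p n
  blur _       []      = []
  blur zero    (_ ∷ x) = nothing ∷ x
  blur (suc j) (_ ∷ x) = just o ∷ blur j x

  fill-mono : ∀ {n} j {x y : Partial p n} → x ≼ y → fill j x ≼ fill j y
  fill-mono zero    q       = q
  fill-mono (suc j) []      = []
  fill-mono (suc j) (_ ∷ q) = same ∷ fill-mono j q

  blur-mono : ∀ {n} j {x y : Partial p n} → x ≼ y → blur j x ≼ blur j y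
  blur-mono _       []      = []
  blur-mono zero    (_ ∷ q) = star ∷ q
  blur-mono (suc j) (_ ∷ q) = same ∷ blur-mono j q

  fill≼blur : ∀ {n} j (x : Partial p n) → fill j x ≼ blur j x
  fill≼blur zero    []      = []
  fill≼blur zero    (_ ∷ x) = star ∷ ≼-refl
  fill≼blur (suc j) []      = []
  fill≼blur (suc j) (_ ∷ x) = same ∷ fill≼blur j x

  fill-suc≼blur : ∀ {n} j (x : Partial p n) → fill (suc j) x ≼ blur j x
  fill-suc≼blur _       []      = []
  fill-suc≼blur zero    (_ ∷ x) = star ∷ ≼-refl
  fill-suc≼blur (suc j) (_ ∷ x) = same ∷ fill-suc≼blur j x

  stars-fill : ∀ {n} j (x : Partial p n) → stars (fill j x) ≤ stars x
  stars-fill zero    x             = ≤-refl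
  stars-fill (suc j) []            = z≤n
  stars-fill (suc j) (nothing ∷ x) = m≤n⇒m≤1+n (stars-fill j x)
  stars-fill (suc j) (just _ ∷ x)  = stars-fill j x

  stars-blur : ∀ {n} j (x : Partial p n) → stars (blur j x) ≤ suc (stars x)
  stars-blur _       []            = z≤n
  stars-blur zero    (nothing ∷ x) = n≤1+n _
  stars-blur zero    (just _ ∷ x)  = ≤-refl
  stars-blur (suc j) (nothing ∷ x) = m≤n⇒m≤1+n (stars-blur j x)
  stars-blur (suc j) (just _ ∷ x)  = stars-blur j x

  fill-all : ∀ {n} (x : Partial p n) → fill n x ≡ Vec.replicate n (just o)
  fill-all []      = refl
  fill-all (_ ∷ x) = cong (just o ∷_) (fill-all x)

  completion : ∀ {n} → Partial p n → Vec (Fin p) n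
  completion = Vec.map (Maybe.fromMaybe o)

  completion-≼ : ∀ {n} (x : Partial p n) → Vec.map just (completion x) ≼ x
  completion-≼ []            = []
  completion-≼ (nothing ∷ x) = star ∷ completion-≼ x
  completion-≼ (just _ ∷ x)  = same ∷ completion-≼ x

  stars-replicate : ∀ n → stars (Vec.replicate n (just o)) ≡ 0
  stars-replicate zero    = refl
  stars-replicate (suc n) = stars-replicate n

-- The action of ℤ/p by adding constants

module _ {p : ℕ} .{{_ : NonZero p}} where

  rotate : ℕ → Fin p → Fin p
  rotate g a = (toℕ a + g) mod p

  toℕ-rotate : ∀ g a → toℕ (rotate g a) ≡ (toℕ a + g) % p
  toℕ-rotate g a = toℕ-fromℕ< (m%n<n (toℕ a + g) p)

  toℕ-% : ∀ (a : Fin p) → toℕ a % p ≡ toℕ a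
  toℕ-% a = m<n⇒m%n≡m (toℕ<n a)

  %-absorbˡ : ∀ m n → (m % p + n) % p ≡ (m + n) % p
  %-absorbˡ m n = begin
    (m % p + n) % p            ≡⟨ %-distribˡ-+ (m % p) n p ⟩
    (m % p % p + n % p) % p    ≡⟨ cong (λ t → (t + n % p) % p) (m%n%n≡m%n m p) ⟩
    (m % p + n % p) % p        ≡⟨ %-distribˡ-+ m n p ⟨
    (m + n) % p                ∎
    where open ≡-Reasoning

  rotate-rotate : ∀ g h a → rotate g (rotate h a) ≡ rotate (h + g) a
  rotate-rotate g h a = toℕ-injective (begin
    toℕ (rotate g (rotate h a))    ≡⟨ toℕ-rotate g (rotate h a) ⟩
    (toℕ (rotate h a) + g) % p     ≡⟨ cong (λ t → (t + g) % p) (toℕ-rotate h a) ⟩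
    ((toℕ a + h) % p + g) % p      ≡⟨ %-absorbˡ (toℕ a + h) g ⟩
    (toℕ a + h + g) % p            ≡⟨ cong (_% p) (+-assoc (toℕ a) h g) ⟩
    (toℕ a + (h + g)) % p          ≡⟨ toℕ-rotate (h + g) a ⟨
    toℕ (rotate (h + g) a)         ∎)
    where open ≡-Reasoning

  rotate-p : ∀ a → rotate p a ≡ a
  rotate-p a = toℕ-injective (trans (toℕ-rotate p a) (trans ([m+n]%n≡m%n (toℕ a) p) (toℕ-% a)))

  -- The difference `b - a` in ℤ/p, the unique rotation that takes `a` to `b`.
  unrotate : Fin p → Fin p → Fin p
  unrotate a = rotate (p ∸ toℕ a)

  a+[p∸a]≡p : ∀ (a : Fin p) → toℕ a + (p ∸ toℕ a) ≡ p
  a+[p∸a]≡p a = m+[n∸m]≡n (<⇒≤ (toℕ<n a))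

  unrotate-rotate : ∀ a g → unrotate a (rotate (toℕ g) a) ≡ g
  unrotate-rotate a g = toℕ-injective (begin
    toℕ (unrotate a (rotate (toℕ g) a))            ≡⟨ cong toℕ (rotate-rotate (p ∸ toℕ a) (toℕ g) a) ⟩
    toℕ (rotate (toℕ g + (p ∸ toℕ a)) a)           ≡⟨ toℕ-rotate _ a ⟩
    (toℕ a + (toℕ g + (p ∸ toℕ a))) % p            ≡⟨ cong (_% p) (swap (toℕ a) (toℕ g) (p ∸ toℕ a)) ⟩
    (toℕ g + (toℕ a + (p ∸ toℕ a))) % p            ≡⟨ cong (λ t → (toℕ g + t) % p) (a+[p∸a]≡p a) ⟩
    (toℕ g + p) % p                                ≡⟨ [m+n]%n≡m%n (toℕ g) p ⟩
    toℕ g % p                                      ≡⟨ toℕ-% g ⟩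
    toℕ g                                          ∎)
    where
    open ≡-Reasoning
    swap : ∀ a b c → a + (b + c) ≡ b + (a + c)
    swap a b c = trans (sym (+-assoc a b c)) (trans (cong (_+ c) (+-comm a b)) (+-assoc b a c))

  rotate-unrotate : ∀ a b → rotate (toℕ (unrotate a b)) a ≡ b
  rotate-unrotate a b = toℕ-injective (begin
    toℕ (rotate (toℕ (unrotate a b)) a)            ≡⟨ toℕ-rotate _ a ⟩
    (toℕ a + toℕ (unrotate a b)) % p               ≡⟨ cong (λ t → (toℕ a + t) % p) (toℕ-rotate (p ∸ toℕ a) b) ⟩
    (toℕ a + (toℕ b + (p ∸ toℕ a)) % p) % p        ≡⟨ cong (_% p) (+-comm (toℕ a) _) ⟩
    ((toℕ b + (p ∸ toℕ a)) % p + toℕ a) % p        ≡⟨ %-absorbˡ (toℕ b + (p ∸ toℕ a)) (toℕ a) ⟩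
    (toℕ b + (p ∸ toℕ a) + toℕ a) % p              ≡⟨ cong (_% p) (+-assoc (toℕ b) (p ∸ toℕ a) (toℕ a)) ⟩
    (toℕ b + (p ∸ toℕ a + toℕ a)) % p              ≡⟨ cong (λ t → (toℕ b + t) % p) (trans (+-comm (p ∸ toℕ a) (toℕ a)) (a+[p∸a]≡p a)) ⟩
    (toℕ b + p) % p                                ≡⟨ [m+n]%n≡m%n (toℕ b) p ⟩
    toℕ b % p                                      ≡⟨ toℕ-% b ⟩
    toℕ b                                          ∎)
    where open ≡-Reasoning

  actʷ : ∀ {n} → ℕ → Vec (Fin p) n → Vec (Fin p) n
  actʷ g = Vec.map (rotate g)

  act : ∀ {n} → ℕ → Partial p n → Partial p n
  act g = Vec.map (Maybe.map (rotate g))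

  actʷ-actʷ : ∀ {n} g h (w : Vec (Fin p) n) → actʷ g (actʷ h w) ≡ actʷ (h + g) w
  actʷ-actʷ g h w = trans (sym (Vec.map-∘ (rotate g) (rotate h) w)) (Vec.map-cong (rotate-rotate g h) w)

  actʷ-p : ∀ {n} (w : Vec (Fin p) n) → actʷ p w ≡ w
  actʷ-p w = trans (Vec.map-cong rotate-p w) (Vec.map-id w)

  act-act : ∀ {n} g h (x : Partial p n) → act g (act h x) ≡ act (h + g) x
  act-act g h x = trans (sym (Vec.map-∘ _ _ x))
    (Vec.map-cong (λ { nothing → refl ; (just a) → cong just (rotate-rotate g h a) }) x)

  act-p : ∀ {n} (x : Partial p n) → act p x ≡ x
  act-p x = trans (Vec.map-cong (λ { nothing → refl ; (just a) → cong just (rotate-p a) }) x) (Vec.map-id x)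

  act-mono : ∀ {n} g {x y : Partial p n} → x ≼ y → act g x ≼ act g y
  act-mono g = Pointwise.map⁺ (⊑-map (rotate g))

  act-just : ∀ {n} g (w : Vec (Fin p) n) → act g (Vec.map just w) ≡ Vec.map just (actʷ g w)
  act-just g w = trans (sym (Vec.map-∘ _ just w)) (Vec.map-∘ just (rotate g) w)

  -- Rainbow coordinates and hyperedges

  ∈-⋃⁺ : ∀ {b : Fin p} {s} {ss : List (Subset p)} → s ∈ˡ ss → b ∈ s → b ∈ ⋃ ss
  ∈-⋃⁺ (here refl) b∈s = x∈p∪q⁺ (inj₁ b∈s)
  ∈-⋃⁺ (there q)   b∈s = x∈p∪q⁺ (inj₂ (∈-⋃⁺ q b∈s))

  symbolCount-full : ∀ {n} (x : Fin p → Vec (Fin p) n) i → (∀ b → ∃ λ j → lookup (x j) i ≡ b) → symbolCount x i ≡ p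
  symbolCount-full x i surj = trans
    (cong ∣_∣ (⊆-antisym (⊆-max _) λ {b} _ → let (j , eq) = surj b in
      ∈-⋃⁺ (∈-map⁺ (λ j → ⁅ lookup (x j) i ⁆) (∈-allFin j)) (subst (λ t → b ∈ ⁅ t ⁆) (sym eq) (x∈⁅x⁆ b))))
    (∣⊤∣≡n p)

-- Every coordinate is a star of `x` or is counted by the filter. The function `h` generalises the
-- list of all coordinates so that the induction can pass to the tail.
filter-length : ∀ {p n} {A : Set} {P : A → Set} (P? : Decidable P) (h : Fin n → A) (x : Partial p n) →
  (∀ i a → lookup x i ≡ just a → P (h i)) → n ≤ stars x + length (filter P? (tabulate h))
filter-length P? h []            q = z≤n
filter-length P? h (nothing ∷ x) q with P? (h zero)
... | yes _ = s≤s (≤-trans (filter-length P? (h ∘ suc) x (q ∘ suc)) (+-monoʳ-≤ (stars x) (n≤1+n _)))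
... | no  _ = s≤s (filter-length P? (h ∘ suc) x (q ∘ suc))
filter-length P? h (just a ∷ x)  q with P? (h zero)
... | yes _ = ≤-trans (s≤s (filter-length P? (h ∘ suc) x (q ∘ suc))) (≤-reflexive (sym (+-suc (stars x) _)))
... | no ¬P = contradiction (q zero a refl) ¬P

symbol : ∀ {p n} (x : Partial p n) → stars x < n → ∃₂ λ i a → lookup x i ≡ just a
symbol (nothing ∷ x) (s≤s q) = let (i , a , eq) = symbol x q in suc i , a , eq
symbol (just a ∷ x)  _       = zero , a , refl

lookup-≼ : ∀ {p n} {w : Vec (Fin p) n} {x : Partial p n} → Vec.map just w ≼ x → ∀ i {a} → lookup x i ≡ just a → lookup w i ≡ a
lookup-≼ {w = b ∷ w} {x = just _ ∷ x} (same ∷ q) zero    refl = refl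
lookup-≼ {w = b ∷ w} {x = _ ∷ x}      (_ ∷ q)    (suc i) eq   = lookup-≼ q i eq

module _ {p n t : ℕ} .{{_ : NonZero p}} where

  -- At a coordinate where `x` has a symbol `a`, all words `w g` carry `a`, so after rotation the
  -- symbols `a + g` exhaust the alphabet. At least one such coordinate exists, and it already
  -- separates the words.
  rotated-edge : (x : Partial p n) → stars x ≤ t → stars x < n → (w : Fin p → Vec (Fin p) n) →
    (∀ g → Vec.map just (w g) ≼ x) → UniformHypergraph.IsEdge (KH p n t) (λ g → actʷ (toℕ g) (w g))
  rotated-edge x ≤t <n w w≼x = injective , m≤n+o⇒m∸n≤o n t (≤-trans
      (filter-length (λ i → symbolCount e i ≟ p) id x λ i a eq → symbolCount-full e i λ b →
        unrotate a b , trans (coordinate eq (unrotate a b)) (rotate-unrotate a b))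
      (+-monoˡ-≤ _ ≤t))
    where
    e : Fin p → Vec (Fin p) n
    e g = actʷ (toℕ g) (w g)
    coordinate : ∀ {i a} → lookup x i ≡ just a → ∀ g → lookup (e g) i ≡ rotate (toℕ g) a
    coordinate {i} eq g = trans (Vec.lookup-map i (rotate (toℕ g)) (w g)) (cong (rotate (toℕ g)) (lookup-≼ (w≼x g) i eq))
    injective : Injective _≡_ _≡_ e
    injective {g} {h} eg≡eh = let (i , a , eq) = symbol x <n in begin
      g                              ≡⟨ unrotate-rotate a g ⟨
      unrotate a (rotate (toℕ g) a)  ≡⟨ cong (unrotate a) (coordinate eq g) ⟨
      unrotate a (lookup (e g) i)    ≡⟨ cong (λ v → unrotate a (lookup v i)) eg≡eh ⟩
      unrotate a (lookup (e h) i)    ≡⟨ cong (unrotate a) (coordinate eq h) ⟩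
      unrotate a (rotate (toℕ h) a)  ≡⟨ unrotate-rotate a h ⟩
      h                              ∎
      where open ≡-Reasoning

-- The partition of unity of a colouring

sum< : ℕ → (ℕ → ℕ) → ℕ
sum< zero    h = 0
sum< (suc n) h = sum< n h + h n

sum<-mono : ∀ n {h k : ℕ → ℕ} → (∀ i → i < n → h i ≤ k i) → sum< n h ≤ sum< n k
sum<-mono zero    le = z≤n
sum<-mono (suc n) le = +-mono-≤ (sum<-mono n (λ i i<n → le i (m<n⇒m<1+n i<n))) (le n (n<1+n n))

sum<-cong : ∀ n {h k : ℕ → ℕ} → (∀ i → h i ≡ k i) → sum< n h ≡ sum< n k
sum<-cong zero    eq = refl
sum<-cong (suc n) eq = cong₂ _+_ (sum<-cong n eq) (eq n)

sum<-rigid : ∀ n {h k : ℕ → ℕ} → (∀ i → i < n → h i ≤ k i) → sum< n k ≤ sum< n h → ∀ i → i < n → h i ≡ k i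
sum<-rigid (suc n) {h} {k} le ge i i<1+n with m≤n⇒m<n∨m≡n (s≤s⁻¹ i<1+n)
... | inj₁ i<n = sum<-rigid n le′ (+-cancelʳ-≤ (k n) _ _ (≤-trans ge (+-monoʳ-≤ (sum< n h) (le n (n<1+n n))))) i i<n
  where
  le′ : ∀ i → i < n → h i ≤ k i
  le′ i i<n = le i (m<n⇒m<1+n i<n)
... | inj₂ refl = ≤-antisym (le n (n<1+n n))
  (+-cancelˡ-≤ (sum< n k) _ _ (≤-trans ge (+-monoˡ-≤ (h n) (sum<-mono n (λ i i<n → le i (m<n⇒m<1+n i<n))))))

sum<-const : ∀ n m → sum< n (const m) ≡ n * m
sum<-const zero    m = refl
sum<-const (suc n) m = trans (cong (_+ m) (sum<-const n m)) (+-comm (n * m) m)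

sum<-shift : ∀ n (h : ℕ → ℕ) → sum< n (h ∘ suc) + h 0 ≡ sum< n h + h n
sum<-shift zero    h = refl
sum<-shift (suc n) h = begin
  sum< n (h ∘ suc) + h (suc n) + h 0    ≡⟨ swap (sum< n (h ∘ suc)) (h (suc n)) (h 0) ⟩
  sum< n (h ∘ suc) + h 0 + h (suc n)    ≡⟨ cong (_+ h (suc n)) (sum<-shift n h) ⟩
  sum< n h + h n + h (suc n)            ∎
  where
  open ≡-Reasoning
  swap : ∀ a b c → a + b + c ≡ a + c + b
  swap a b c = trans (+-assoc a b c) (trans (cong (λ t → a + t) (+-comm b c)) (sym (+-assoc a c b)))

sum<-cyclic : ∀ n {h : ℕ → ℕ} → h n ≡ h 0 → sum< n (h ∘ suc) ≡ sum< n h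
sum<-cyclic n {h} eq = +-cancelʳ-≡ (h 0) _ _ (trans (sum<-shift n h) (cong (λ t → sum< n h + t) eq))

bit : Bool → ℕ
bit false = 0
bit true  = 1

bit≤1 : ∀ b → bit b ≤ 1
bit≤1 false = z≤n
bit≤1 true  = ≤-refl

bit-injective : ∀ {a b} → bit a ≡ bit b → a ≡ b
bit-injective {false} {false} _ = refl
bit-injective {true}  {true}  _ = refl

bit-mono : ∀ {A B : Set} (A? : Dec A) (B? : Dec B) → (A → B) → bit (does A?) ≤ bit (does B?)
bit-mono (no _)  B? f = z≤n
bit-mono (yes a) B? f = ≤-reflexive (cong bit (sym (dec-true B? (f a))))

lift-eq : ∀ {d} y n x m → d + y * n ≡ x * m → + d +ᶻ + y *ᶻ + n ≡ + x *ᶻ + m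
lift-eq {d} y n x m eq = trans (cong (+ d +ᶻ_) (sym (ℤₚ.pos-* y n))) (trans (cong +_ eq) (ℤₚ.pos-* x m))

module Selection (p : ℕ) where

  count : (ℕ → Bool) → ℕ
  count s = sum< p (bit ∘ s)

  count-max : ∀ {s} → p ≤ count s → ∀ g → g < p → s g ≡ true
  count-max {s} p≤ g g<p = bit-injective (sum<-rigid p (λ i _ → bit≤1 (s i))
    (≤-trans (≤-reflexive (trans (sum<-const p 1) (*-identityʳ p))) p≤) g g<p)

  bezout : ∀ q → ∃₂ λ u v → u *ᶻ + q +ᶻ v *ᶻ + p ≡ + gcd q p
  bezout q with Bézout.identity (gcd-GCD q p)
  ... | Bézout.+- x y eq = + x , neg (+ y) ,
    trans (cong (_+ᶻ neg (+ y) *ᶻ + p) (sym (lift-eq y p x q eq))) (cancel (+ gcd q p) (+ y) (+ p))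
    where
    cancel : ∀ d y n → (d +ᶻ y *ᶻ n) +ᶻ neg y *ᶻ n ≡ d
    cancel = solve-∀
  ... | Bézout.-+ x y eq = neg (+ x) , + y ,
    trans (cong (neg (+ x) *ᶻ + q +ᶻ_) (sym (lift-eq x q y p eq))) (cancel (+ gcd q p) (+ x) (+ q))
    where
    cancel : ∀ d y n → neg y *ᶻ n +ᶻ (d +ᶻ y *ᶻ n) ≡ d
    cancel = solve-∀

  -- If b runs through p truth values of which q hold, the weights add up to gcd q p.
  weight : ℕ → Bool → ℤ
  weight q b = let (u , v , _) = bezout q in u *ᶻ + bit b +ᶻ v

  Σ-weight : ∀ q s → Σ< p (λ a → weight q (s a)) ≡ proj₁ (bezout q) *ᶻ + count s +ᶻ proj₁ (proj₂ (bezout q)) *ᶻ + p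
  Σ-weight q s = go p
    where
    u = proj₁ (bezout q)
    v = proj₁ (proj₂ (bezout q))
    go : ∀ m → Σ< m (λ a → weight q (s a)) ≡ u *ᶻ + sum< m (bit ∘ s) +ᶻ v *ᶻ + m
    go zero    = base u v
      where
      base : ∀ u v → 0ℤ ≡ u *ᶻ 0ℤ +ᶻ v *ᶻ 0ℤ
      base = solve-∀
    go (suc m) = trans (cong (_+ᶻ weight q (s m)) (go m)) (step u v (+ sum< m (bit ∘ s)) (+ bit (s m)) (+ m))
      where
      step : ∀ u v a b m → (u *ᶻ a +ᶻ v *ᶻ m) +ᶻ (u *ᶻ b +ᶻ v) ≡ u *ᶻ (a +ᶻ b) +ᶻ v *ᶻ (1ℤ +ᶻ m)
      step = solve-∀

  orElse : ℕ → ℤ → ℤ → ℤ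
  orElse zero    _ b = b
  orElse (suc _) a _ = a

  -- The weight for the largest colour that occurs at all. Rotation preserves the counts, so the
  -- same colour is selected along a whole orbit.
  selector : ℕ → (ℕ → ℕ → Bool) → ℤ
  selector zero    s = 0ℤ
  selector (suc c) s = orElse (count (s c)) (weight (count (s c)) (s c 0)) (selector c s)

  selector-cong : ∀ c {s t} → (∀ i → i < c → count (s i) ≡ count (t i)) → (∀ i → i < c → s i 0 ≡ t i 0) →
    selector c s ≡ selector c t
  selector-cong zero    _  _   = refl
  selector-cong (suc c) {s} {t} eq eq₀
    rewrite eq c (n<1+n c) | eq₀ c (n<1+n c)
          | selector-cong c {s} {t} (λ i i<c → eq i (m<n⇒m<1+n i<c)) (λ i i<c → eq₀ i (m<n⇒m<1+n i<c)) = refl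

  -- r a is the pattern s rotated by a.
  Σ-selector : Prime p → ∀ c (s : ℕ → ℕ → Bool) (r : ℕ → ℕ → ℕ → Bool) →
    (∀ a i → count (r a i) ≡ count (s i)) → (∀ a i → r a i 0 ≡ s i a) →
    (∀ i → i < c → count (s i) < p) → (∃ λ i → i < c × 0 < count (s i)) →
    Σ< p (λ a → selector c (r a)) ≡ 1ℤ
  Σ-selector pp zero    s r eq eq₀ <p (_ , () , _)
  Σ-selector pp (suc c) s r eq eq₀ <p (i , i<1+c , 0<i) with count (s c) in q≡ | <p c (n<1+n c)
  ... | zero  | _ = trans
    (Σ<-cong p λ a → cong (λ q → orElse q (weight q (r a c 0)) (selector c (r a))) (trans (eq a c) q≡))
    (Σ-selector pp c s r eq eq₀ (λ i i<c → <p i (m<n⇒m<1+n i<c)) (i , i<c , 0<i))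
    where
    i<c : i < c
    i<c with m≤n⇒m<n∨m≡n (s≤s⁻¹ i<1+c)
    ... | inj₁ i<c  = i<c
    ... | inj₂ refl = contradiction (subst (0 <_) q≡ 0<i) λ ()
  ... | suc q | q<p = begin
    Σ< p (λ a → selector (suc c) (r a))
      ≡⟨ Σ<-cong p (λ a → cong₂ (λ q b → orElse q (weight q b) (selector c (r a))) (trans (eq a c) q≡) (eq₀ a c)) ⟩
    Σ< p (λ a → weight (suc q) (s c a))
      ≡⟨ Σ-weight (suc q) (s c) ⟩
    u *ᶻ + count (s c) +ᶻ v *ᶻ + p
      ≡⟨ cong (λ t → u *ᶻ + t +ᶻ v *ᶻ + p) q≡ ⟩
    u *ᶻ + suc q +ᶻ v *ᶻ + p
      ≡⟨ proj₂ (proj₂ (bezout (suc q))) ⟩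
    + gcd (suc q) p
      -- Primality enters here: a count strictly between 0 and `p` is coprime to `p`.
      ≡⟨ cong +_ (coprime⇒gcd≡1 (coprime-sym (prime⇒coprime pp q<p))) ⟩
    1ℤ ∎
    where
    open ≡-Reasoning
    u = proj₁ (bezout (suc q))
    v = proj₁ (proj₂ (bezout (suc q)))

-- Hit patterns of a colouring

module Colouring {p c n : ℕ} (pp : Prime p) (χ : Vec (Fin p) n → Fin c) where

  instance
    p≢0 : NonZero p
    p≢0 = prime⇒nonZero pp

  2≤p : 2 ≤ p
  2≤p = nonTrivial⇒n>1 p {{prime⇒nonTrivial pp}}

  open Selection p

  o : Fin p
  o = fromℕ< {0} (≤-trans (s≤s z≤n) 2≤p)

  -- The pairs `(i, g)` attached to `x`. Both indices are natural numbers, so that they can serve as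
  -- summation indices.
  Hit : Partial p n → ℕ → ℕ → Set
  Hit x i g = ∃ λ w → Vec.map just w ≼ x × toℕ (χ (actʷ g w)) ≡ i

  Hit? : ∀ x i g → Dec (Hit x i g)
  Hit? x i g = Vec-searchable any? λ w →
    Pointwise.decidable ⊑-dec (Vec.map just w) x ×-dec (toℕ (χ (actʷ g w)) ≟ i)

  hits : Partial p n → ℕ → ℕ → Bool
  hits x i g = does (Hit? x i g)

  Hit-mono : ∀ {x y} → x ≼ y → ∀ {i g} → Hit x i g → Hit y i g
  Hit-mono x≼y (w , w≼x , eq) = w , ≼-trans w≼x x≼y , eq

  -- Rotation by 1 maps the completions of `x` onto those of `act 1 x`; its inverse is rotation by
  -- `p ∸ 1`.
  hits-act₁ : ∀ x i g → hits (act 1 x) i g ≡ hits x i (suc g)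
  hits-act₁ x i g = does-⇔ (mk⇔ to from) (Hit? (act 1 x) i g) (Hit? x i (suc g))
    where
    p-1+1+g : p ∸ 1 + suc g ≡ p + g
    p-1+1+g = trans (+-suc (p ∸ 1) g) (cong (_+ g) (m+[n∸m]≡n (<⇒≤ 2≤p)))
    to : Hit (act 1 x) i g → Hit x i (suc g)
    to (w , w≼ , eq) = actʷ (p ∸ 1) w
      , subst (_≼ x) (act-just (p ∸ 1) w) (subst (act (p ∸ 1) (Vec.map just w) ≼_)
          (trans (act-act (p ∸ 1) 1 x) (trans (cong (λ m → act m x) (m+[n∸m]≡n (<⇒≤ 2≤p))) (act-p x)))
          (act-mono (p ∸ 1) w≼))
      , trans (cong (toℕ ∘ χ) (begin
          actʷ (suc g) (actʷ (p ∸ 1) w)   ≡⟨ actʷ-actʷ (suc g) (p ∸ 1) w ⟩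
          actʷ (p ∸ 1 + suc g) w          ≡⟨ cong (λ m → actʷ m w) p-1+1+g ⟩
          actʷ (p + g) w                  ≡⟨ actʷ-actʷ g p w ⟨
          actʷ g (actʷ p w)               ≡⟨ cong (actʷ g) (actʷ-p w) ⟩
          actʷ g w                        ∎)) eq
      where open ≡-Reasoning
    from : Hit x i (suc g) → Hit (act 1 x) i g
    from (w , w≼ , eq) = actʷ 1 w , subst (_≼ act 1 x) (act-just 1 w) (act-mono 1 w≼)
      , trans (cong (toℕ ∘ χ) (actʷ-actʷ g 1 w)) eq

  hits-act : ∀ a x i g → hits (act a x) i g ≡ hits x i (a + g)
  hits-act zero    x i g = cong (λ y → hits y i g) (act-zero p act act-act act-p x)
  hits-act (suc a) x i g = begin
    hits (act (suc a) x) i g        ≡⟨ cong (λ y → hits y i g) (act-act a 1 x) ⟨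
    hits (act a (act 1 x)) i g      ≡⟨ hits-act a (act 1 x) i g ⟩
    hits (act 1 x) i (a + g)        ≡⟨ hits-act₁ x i (a + g) ⟩
    hits x i (suc (a + g))          ∎
    where open ≡-Reasoning

  count-act : ∀ a x i → count (hits (act a x) i) ≡ count (hits x i)
  count-act zero    x i = sum<-cong p (λ g → cong bit (hits-act 0 x i g))
  count-act (suc a) x i = begin
    count (hits (act (suc a) x) i)      ≡⟨ cong (λ y → count (hits y i)) (act-act a 1 x) ⟨
    count (hits (act a (act 1 x)) i)    ≡⟨ count-act a (act 1 x) i ⟩
    count (hits (act 1 x) i)            ≡⟨ sum<-cong p (λ g → cong bit (hits-act₁ x i g)) ⟩
    count (hits x i ∘ suc)              ≡⟨ sum<-cyclic p {bit ∘ hits x i} (cong bit hits-p) ⟩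
    count (hits x i)                    ∎
    where
    open ≡-Reasoning
    hits-p : hits x i p ≡ hits x i 0
    hits-p = begin
      hits x i p            ≡⟨ cong (hits x i) (+-identityʳ p) ⟨
      hits x i (p + 0)      ≡⟨ hits-act p x i 0 ⟨
      hits (act p x) i 0    ≡⟨ cong (λ y → hits y i 0) (act-p x) ⟩
      hits x i 0            ∎

  f : Partial p n → ℤ
  f x = selector c (hits x)

  level : Partial p n → ℕ
  level x = sum< c (λ i → count (hits x i))

  hits-mono : ∀ {x y} → x ≼ y → ∀ i g → bit (hits x i g) ≤ bit (hits y i g)
  hits-mono {x} {y} x≼y i g = bit-mono (Hit? x i g) (Hit? y i g) (Hit-mono x≼y)

  count-mono : ∀ {x y} → x ≼ y → ∀ i → count (hits x i) ≤ count (hits y i)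
  count-mono x≼y i = sum<-mono p (λ g _ → hits-mono x≼y i g)

  level-mono : ∀ {x y} → x ≼ y → level x ≤ level y
  level-mono x≼y = sum<-mono c (λ i _ → count-mono x≼y i)

  -- The level counts the attached pairs, which can only be gained along `≼`. If none is gained, the
  -- hit patterns agree, and `f` depends on the pattern alone.
  level-rigid : ∀ {x y} → x ≼ y → level y ≤ level x → ∀ a → a < p → f (act a x) ≡ f (act a y)
  level-rigid {x} {y} x≼y ≥ a a<p = selector-cong c
    (λ i i<c → trans (count-act a x i) (trans (counts i i<c) (sym (count-act a y i))))
    (λ i i<c → trans (hits-act a x i 0) (trans (values i i<c) (sym (hits-act a y i 0))))
    where
    counts : ∀ i → i < c → count (hits x i) ≡ count (hits y i)
    counts = sum<-rigid c (λ i _ → count-mono x≼y i) ≥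
    values : ∀ i → i < c → hits x i (a + 0) ≡ hits y i (a + 0)
    values i i<c = bit-injective (sum<-rigid p (λ g _ → hits-mono x≼y i g)
      (≤-reflexive (sym (counts i i<c))) (a + 0) (subst (_< p) (sym (+-identityʳ a)) a<p))

  -- Vanishing of high powers and the contradiction

  module _ (T : ℕ) (¬full : ∀ x → stars x ≤ T → ∀ (i : Fin c) → ¬ (∀ (g : Fin p) → Hit x (toℕ i) (toℕ g))) where

    Good : Partial p n → Set
    Good x = stars x ≤ T

    count<p : ∀ {x} → Good x → ∀ i → i < c → count (hits x i) < p
    count<p {x} gx i i<c = ≰⇒> λ p≤count → ¬full x gx (fromℕ< i<c) λ g →
      subst (λ j → Hit x j (toℕ g)) (sym (toℕ-fromℕ< i<c))
        (does-true (Hit? x i (toℕ g)) (count-max {hits x i} p≤count (toℕ g) (toℕ<n g)))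
      where
      does-true : ∀ {A : Set} (A? : Dec A) → does A? ≡ true → A
      does-true (yes a) _ = a

    -- Each of the `c` colours misses at least one of the `p` rotations.
    level≤ : ∀ {x} → Good x → level x ≤ c * (p ∸ 1)
    level≤ gx = ≤-trans (sum<-mono c (λ i i<c → pred-mono-≤ (count<p gx i i<c))) (≤-reflexive (sum<-const c (p ∸ 1)))

    Σf≡1 : ∀ {x} → Good x → Σ< p (λ a → f (act a x)) ≡ 1ℤ
    Σf≡1 {x} gx = Σ-selector pp c (hits x) (λ a → hits (act a x))
      (λ a i → count-act a x i) (λ a i → trans (hits-act a x i 0) (cong (hits x i) (+-identityʳ a)))
      (count<p gx) (toℕ i , toℕ<n i , positive)
      where
      -- Any completion contributes a pair with `g = 0`, so some colour has a positive count.
      w = completion o x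
      i = χ (actʷ 0 w)
      positive : 0 < count (hits x (toℕ i))
      positive = ≤-trans (≤-reflexive (cong bit (sym (dec-true (Hit? x (toℕ i) 0) (w , completion-≼ o x , refl)))))
        (term≤sum p (≤-trans (s≤s z≤n) 2≤p))
        where
        term≤sum : ∀ m {h : ℕ → ℕ} → 0 < m → h 0 ≤ sum< m h
        term≤sum (suc zero)    _ = ≤-refl
        term≤sum (suc (suc m)) {h} _ = ≤-trans (term≤sum (suc m) {h} (s≤s z≤n)) (m≤m+n _ _)

    open PartitionOfUnity p act act-act act-p f Good
      (λ a {x} gx → subst (_≤ T) (sym (stars-map (rotate a) x)) gx) Σf≡1
    open Chains {Partial p n} _≼_ stars

    open Contraction ≼-refl n (Vec.replicate n (just o)) (fill o) (blur o)
      (fill-mono o) (blur-mono o) (fill≼blur o) (fill-suc≼blur o) (stars-fill o) (stars-blur o)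
      (λ _ → refl) (fill-all o)

    open Descent Adm T
      (λ a → Adm-map (act-mono a) (λ x → ≤-reflexive (stars-map (rotate a) x)))
      Adm-nonempty
      (λ k≤T q → All.map (λ r → ≤-trans r k≤T) (Adm.ranks q))
      exact

    -- Induction on the number of factors. If the level does not grow on the first triple, its
    -- factor `B` is 0. Otherwise the chain from `z` on starts at a higher level, which makes up for
    -- the lost factor in the inequality. With no factor left, the level would exceed its maximum.
    W-vanishes : ∀ k {x xs} → Linked _≼_ (x ∷ xs) → All Good (x ∷ xs) → length xs ≡ k * 2 →
      c * (p ∸ 1) < level x + k → W k (x ∷ xs) ≡ 0ℤ
    W-vanishes zero    {x} _ (gx ∷ _) _ big =
      contradiction (level≤ gx) (<⇒≱ (subst (c * (p ∸ 1) <_) (+-identityʳ (level x)) big))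
    W-vanishes (suc k) {x} {y ∷ z ∷ zs} (x≼y ∷ y≼z ∷ ch) (gx ∷ gy ∷ gz ∷ gzs) size big
      with level z ≤? level x
    ... | yes z≤x = trans (W-suc k x y z zs) (cong (_*ᶻ W k (z ∷ zs)) (trans
      (cong₂ (λ s t → (s -ᶻ t) +ᶻ F₁ x y)
        (F₁-vanishes (level-rigid y≼z (≤-trans z≤x (level-mono x≼y))))
        (F₁-vanishes (level-rigid (≼-trans x≼y y≼z) z≤x)))
      (trans (ℤₚ.+-identityˡ (F₁ x y)) (F₁-vanishes (level-rigid x≼y (≤-trans (level-mono y≼z) z≤x))))))
    ... | no z≰x = trans (W-suc k x y z zs) (trans
      (cong (B x y z *ᶻ_) (W-vanishes k ch (gz ∷ gzs) (suc-injective (suc-injective size))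
        (≤-trans big (≤-trans (≤-reflexive (+-suc (level x) k)) (+-monoˡ-≤ k (≰⇒> z≰x))))))
      (ℤₚ.*-zeroʳ (B x y z)))

    contradictory : suc (c * (p ∸ 1)) * 2 ≤ T → ⊥
    contradictory ≤T = ¬NullCohomologous 2≤p
      {Vec.replicate n (just o)} (adm refl [-] (≤-reflexive (stars-replicate o n) ∷ []))
      K ≤T (const 0ℤ , vanishing)
      where
      -- The least exponent that exceeds every possible growth of the level, so that `W K` vanishes
      -- whatever the level of the first element is. The zero cochain is then a primitive.
      K = suc (c * (p ∸ 1))
      d-N-0 : ∀ xs → d (N (const 0ℤ)) xs ≡ 0ℤ
      d-N-0 xs = trans (d-N (const 0ℤ) xs) (Σ<-zero p (λ a _ → d-zero (List.map (act a) xs)))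
      vanishing : ∀ xs → Adm (K * 2) xs → W K xs ≡ d (N (const 0ℤ)) xs
      vanishing (x ∷ xs) (adm size ch rs) = trans
        (W-vanishes K ch (All.map (λ r → ≤-trans r ≤T) rs) (suc-injective size) (m≤n+m K (level x)))
        (sym (d-N-0 (x ∷ xs)))

  -- Search for a partial word and a colour hit by all rotations. A result gives the edge, and
  -- failure of the search is the hypothesis of `contradictory` with `T = t`.
  monochromatic-edge : ∀ {t} → suc (c * (p ∸ 1)) * 2 ≤ t → t < n → HasMonochromaticEdge (KH p n t) χ
  monochromatic-edge {t} ≤t t<n
    with Vec-searchable (Maybe-searchable any?) (λ x → (stars x ≤? t) ×-dec
           any? (λ (i : Fin c) → all? (λ (g : Fin p) → Hit? x (toℕ i) (toℕ g))))
  ... | no none = ⊥-elim (contradictory t (λ x gx i full → none (x , gx , i , full)) ≤t)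
  ... | yes (x , gx , i , full) = (λ g → actʷ (toℕ g) (w g))
    , rotated-edge x gx (≤-<-trans gx t<n) w (λ g → proj₁ (proj₂ (full g)))
    , λ g h → toℕ-injective (trans (proj₂ (proj₂ (full g))) (sym (proj₂ (proj₂ (full h)))))
    where
    w : Fin p → Vec (Fin p) n
    w g = proj₁ (full g)

-- Few coordinates

length-filter-split : ∀ {A : Set} {P : A → Set} (P? : Decidable P) xs →
  length (filter P? xs) + length (filter (¬? ∘ P?) xs) ≡ length xs
length-filter-split P? []       = refl
length-filter-split P? (x ∷ xs) with does (P? x)
... | true  = cong suc (length-filter-split P? xs)
... | false = trans (+-suc _ _) (cong suc (length-filter-split P? xs))

-- If the class of the last colour has at most `k` elements, removing it leaves more than `c * k`
-- elements in the other colours.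
pigeonhole : ∀ {A : Set} c k (col : A → ℕ) xs → Unique xs → All (λ x → col x < c) xs → c * k < length xs →
  ∃₂ λ ys i → Unique ys × k < length ys × All (λ y → col y ≡ i) ys
pigeonhole zero    k col []       _ _        ()
pigeonhole zero    k col (_ ∷ _)  _ (() ∷ _) _
pigeonhole (suc c) k col xs u below big with k <? length (filter (λ x → col x ≟ c) xs)
... | yes k< = filter (λ x → col x ≟ c) xs , c , Unique.filter⁺ _ u , k< , All.all-filter _ xs
... | no  k≮ = pigeonhole c k col rest (Unique.filter⁺ _ u) rest-below
    (+-cancelˡ-< k _ _ (<-≤-trans big (≤-trans (≤-reflexive (sym (length-filter-split (λ x → col x ≟ c) xs))) (+-monoˡ-≤ (length rest) (≮⇒≥ k≮)))))
  where
  rest = filter (λ x → ¬? (col x ≟ c)) xs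
  rest-below : All (λ x → col x < c) rest
  rest-below = All.zipWith (λ (b , ≢c) → ≤∧≢⇒< (s≤s⁻¹ b) ≢c) (All.filter⁺ _ below , All.all-filter _ xs)

Unique-lookup : ∀ {A : Set} {xs : List A} → Unique xs → Injective _≡_ _≡_ (List.lookup xs)
Unique-lookup (_ ∷ _) {zero}  {zero}  _  = refl
Unique-lookup (n ∷ _) {zero}  {suc j} eq = contradiction eq (All.lookup n (∈-lookup j))
Unique-lookup (n ∷ _) {suc i} {zero}  eq = contradiction (sym eq) (All.lookup n (∈-lookup i))
Unique-lookup (_ ∷ u) {suc i} {suc j} eq = cong suc (Unique-lookup u eq)

length-cartesianProductWith : ∀ {A B C : Set} (h : A → B → C) as bs →
  length (cartesianProductWith h as bs) ≡ length as * length bs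
length-cartesianProductWith h []       bs = refl
length-cartesianProductWith h (a ∷ as) bs = trans (length-++ (map (h a) bs))
  (cong₂ _+_ (length-map (h a) bs) (length-cartesianProductWith h as bs))

words : ∀ p n → List (Vec (Fin p) n)
words p zero    = [] ∷ []
words p (suc n) = cartesianProductWith _∷_ (allFin p) (words p n)

words-unique : ∀ p n → Unique (words p n)
words-unique p zero    = [] ∷ []
words-unique p (suc n) = Unique.cartesianProductWith⁺ _∷_ Vec.∷-injective (Unique.allFin⁺ p) (words-unique p n)

length-words : ∀ p n → length (words p n) ≡ p ^ n
length-words p zero    = refl
length-words p (suc n) = trans (length-cartesianProductWith _∷_ (allFin p) (words p n))
  (cong₂ _*_ (length-tabulate {n = p} id) (length-words p n))

monochromatic-edge-small : ∀ {p c n t} → 2 ≤ p → n ≤ t → c * (p ∸ 1) < p ^ n → (χ : Vec (Fin p) n → Fin c) →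
  HasMonochromaticEdge (KH p n t) χ
monochromatic-edge-small {p} {c} {n} {t} 2≤p n≤t many χ
  with pigeonhole c (p ∸ 1) (toℕ ∘ χ) (words p n) (words-unique p n) (All.universal (toℕ<n ∘ χ) _)
         (subst (c * (p ∸ 1) <_) (sym (length-words p n)) many)
... | ys , i , u , large , mono = x
    , ((λ eq → inject≤-injective p≤ p≤ _ _ (Unique-lookup u eq)) , ≤-trans (≤-reflexive (m≤n⇒m∸n≡0 n≤t)) z≤n)
    , λ g h → toℕ-injective (trans (colour g) (sym (colour h)))
  where
  p≤ : p ≤ length ys
  p≤ = ≤-trans (≤-reflexive (sym (m+[n∸m]≡n (<⇒≤ 2≤p)))) large
  x : Fin p → Vec (Fin p) n
  x g = List.lookup ys (inject≤ g p≤)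
  colour : ∀ g → toℕ (χ (x g)) ≡ i
  colour g = All.lookup mono (∈-lookup (inject≤ g p≤))

-- The numerical bound and the conclusion

stars-suffice : ∀ p c → 2 ≤ p → 1 ≤ c → suc (c * (p ∸ 1)) * 2 ≤ p ^ 2 * c
stars-suffice (suc zero)    c (s≤s ()) _
stars-suffice (suc (suc q)) c _ 1≤c = ≤-trans
  -- With `p = q + 2`, subtracting `2 c (p - 1)` from `p² c` leaves `(q² + 2 q + 2) c`, which is at
  -- least 2 as `c ≥ 1`.
  (+-monoˡ-≤ _ (*-mono-≤ {2} {2 + (q * q + 2 * q)} (m≤m+n 2 _) 1≤c))
  (≤-reflexive (expand q c))
  where
  open Data.Nat.Solver.+-*-Solver
  expand : ∀ q c → (2 + (q * q + 2 * q)) * c + c * suc q * 2 ≡ suc (suc q) ^ 2 * c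
  expand = solve 2 (λ q c → (con 2 :+ (q :* q :+ con 2 :* q)) :* c :+ c :* (con 1 :+ q) :* con 2
                         := (con 2 :+ q) :^ 2 :* c) refl

monochromatic-edge-exists : ∀ {p c n} → Prime p → 1 ≤ c → c * (p ∸ 1) < p ^ n →
  (χ : Vec (ℤ/ p) n → Fin c) → HasMonochromaticEdge (KH p n (p ^ 2 * c)) χ
monochromatic-edge-exists {p} {c} {n} pp 1≤c many χ with n ≤? p ^ 2 * c
... | yes n≤t = monochromatic-edge-small (nonTrivial⇒n>1 p {{prime⇒nonTrivial pp}}) n≤t many χ
... | no  n≰t = Colouring.monochromatic-edge pp χ (stars-suffice p c (nonTrivial⇒n>1 p {{prime⇒nonTrivial pp}}) 1≤c) (≰⇒> n≰t)

theorem5p2 : (p c n : ℕ) → Prime p → ¬ (2 ∣ p) → 1 ≤ c → 1 ≤ n →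
    c * (p ∸ 1) < p ^ n →
    (∀ k → IsChromaticNumber (KH p n (p ^ 2 * c)) k → suc c ≤ k)
    × ((χ : Vec (ℤ/ p) n → Fin c) → HasMonochromaticEdge (KH p n (p ^ 2 * c)) χ)
theorem5p2 p c n pp _ 1≤c _ many = chromatic , edge
  where
  edge : (χ : Vec (ℤ/ p) n → Fin c) → HasMonochromaticEdge (KH p n (p ^ 2 * c)) χ
  edge = monochromatic-edge-exists pp 1≤c many
  chromatic : ∀ k → IsChromaticNumber (KH p n (p ^ 2 * c)) k → suc c ≤ k
  chromatic k ((χ , proper) , _) = ≰⇒> λ k≤c →
    -- Included into `Fin c`, a proper colouring with `k ≤ c` colours stays proper, since the
    -- inclusion is injective.
    let (x , isEdge , mono) = edge (λ v → inject≤ (χ v) k≤c)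
    in proper (x , isEdge , λ i j → inject≤-injective k≤c k≤c _ _ (mono i j))
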